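{- Consider the symmetric group $\mathfrak{S}_n$ as a poset under the Bruhat order, and let $\sigma_k\le w$. The interval $[\sigma_k,w]$ is boolean (equivalently, a modular lattice, or a distributive lattice) if and only if there is a reduced decomposition $x\,\sigma_k\,y\in R(w)$ such that (1) $x$ and $y$ are each (possibly empty) products of distinct generators; (2) the only generators that may appear in both $x$ and $y$ are $\sigma_{k-1}$ and $\sigma_{k+1}$; and (3) $\sigma_k$ does not appear in $x$ or in $y$.
   Context: $\mathfrak{S}_n$ is the symmetric group with Coxeter generators $\sigma_1,\dots,\sigma_{n-1}$, where $\sigma_i$ is the transposition swapping $i$ and $i+1$; here $1\le k\le n-1$. A reduced decomposition of $w$ is a word $s_1\cdots s_\ell$ in these generators with product $w$ and $\ell$ minimal; $R(w)$ is the set of reduced decompositions of $w$. Bruhat order: $v\le w$ if some reduced decomposition of $v$ is a (not necessarily contiguous) subword of a reduced decomposition of $w$. $[v,w]=\{u: v\le u\le w\}$. A poset is boolean if it is isomorphic to the poset of all subsets of a finite set, ordered by inclusion. In the claim $x$ and $y$ are words in the generators. -}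

module Defs where

open import Data.Fin.Base using (Fin; suc; inject₁)
open import Data.Fin.Permutation using (Permutation′; transpose; id; _∘ₚ_; _≈_)
open import Data.Fin.Subset using (Subset) renaming (_⊆_ to _⊆ₛ_)
open import Data.List.Base using (List; []; _∷_; length)
open import Data.List.Relation.Binary.Sublist.Propositional using (_⊆_)
open import Data.Nat.Base using (ℕ; suc; _≤_)
open import Data.Product.Base using (Σ; ∃; _×_; proj₁)
open import Algebra.Core using (Op₂)
open import Function.Base using (_on_)
open import Level using (Level; 0ℓ; _⊔_)
open import Relation.Binary.Bundles.Raw using (RawRelation)
open import Relation.Binary.Core using (Rel)
open import Relation.Binary.Lattice.Structures using (IsLattice; IsDistributiveLattice)
open import Relation.Binary.Morphism.Structures using (IsOrderIsomorphism)
open import Relation.Binary.PropositionalEquality.Core using (_≡_)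

-- The symmetric group 𝔖ₙ with n = suc m, so that Fin m indexes its n − 1
-- Coxeter generators.  Permutations are compared by the pointwise _≈_.
𝔖 : ℕ → Set
𝔖 m = Permutation′ (suc m)

-- Indices are 0-based: the i-th generator swaps i and i + 1 in {0, …, m}.
σ : ∀ {m} → Fin m → 𝔖 m
σ i = transpose (inject₁ i) (suc i)

Word : ℕ → Set
Word m = List (Fin m)

-- _∘ₚ_ applies its left argument first, so ⟦ i₁ ∷ … ∷ iₗ ∷ [] ⟧ is the product
-- σ i₁ ⋯ σ iₗ for the usual composition of functions (rightmost first).
⟦_⟧ : ∀ {m} → Word m → 𝔖 m
⟦ []    ⟧ = id
⟦ i ∷ s ⟧ = ⟦ s ⟧ ∘ₚ σ i

infix 4 _∈R_ _≤ᴮ_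

-- s ∈R w : the word s is a reduced decomposition of w.
_∈R_ : ∀ {m} → Word m → 𝔖 m → Set
s ∈R w = ⟦ s ⟧ ≈ w × (∀ t → ⟦ t ⟧ ≈ w → length s ≤ length t)

-- Bruhat order; _⊆_ is the relation of being a, not necessarily contiguous,
-- subword.
_≤ᴮ_ : ∀ {m} → Rel (𝔖 m) 0ℓ
v ≤ᴮ w = ∃ λ s → ∃ λ t → s ∈R v × t ∈R w × s ⊆ t

-- The order axioms are not bundled.
[_,_] : ∀ {m} → 𝔖 m → 𝔖 m → RawRelation 0ℓ 0ℓ 0ℓ
[_,_] {m} v w = record
  { Carrier = Σ (𝔖 m) λ u → v ≤ᴮ u × u ≤ᴮ w
  ; _≈_     = _≈_ on proj₁
  ; _∼_     = _≤ᴮ_ on proj₁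
  }

module _ {a ℓ₁ ℓ₂ : Level} (P : RawRelation a ℓ₁ ℓ₂) where
  open RawRelation P using (Carrier) renaming (_≈_ to _≈ₚ_; _∼_ to _≤ₚ_)

  -- Up to isomorphism, Fin r runs over the finite sets.
  Boolean : Set (a ⊔ ℓ₁ ⊔ ℓ₂)
  Boolean = ∃ λ r → ∃ λ (f : Carrier → Subset r) →
    IsOrderIsomorphism _≈ₚ_ _≡_ _≤ₚ_ _⊆ₛ_ f

  -- IsLattice and IsDistributiveLattice include that P is a partial order.
  ModularLattice : Set (a ⊔ ℓ₁ ⊔ ℓ₂)
  ModularLattice = ∃ λ (_∨_ : Op₂ Carrier) → ∃ λ (_∧_ : Op₂ Carrier) →
    IsLattice _≈ₚ_ _≤ₚ_ _∨_ _∧_ ×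
    (∀ x y z → x ≤ₚ z → (x ∨ (y ∧ z)) ≈ₚ ((x ∨ y) ∧ z))

  DistributiveLattice : Set (a ⊔ ℓ₁ ⊔ ℓ₂)
  DistributiveLattice = ∃ λ (_∨_ : Op₂ Carrier) → ∃ λ (_∧_ : Op₂ Carrier) →
    IsDistributiveLattice _≈ₚ_ _≤ₚ_ _∨_ _∧_

{-# OPTIONS --safe #-}

-- The Bruhat order is the entrywise order of rank matrices; this gives the exchange and subword
-- properties.  A word x k y satisfying (1)–(3) is automatically reduced, and so are its subwords
-- containing k.  Which letters such a subword contains can be read off the elements i k and k i
-- below its product, so [σ k, w] is the lattice of subsets of the letters of x and y.
--
-- Conversely, suppose [σ k, w] is modular.  If i and j are adjacent generators other than k, then
-- i j k and j i k, having the lower bounds i k and j k in common, are not both below w; similarly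
-- for k i j and k j i.  If i and j are the two neighbours of k, then k i j k is not below w, because
-- [σ k, k i j k] is not modular.  A reduced word of w is now brought into the form x k y, adding one
-- letter at a time from right to left.  A letter other than k that repeats without being allowed
-- to produces one of the excluded pairs, and an additional k is removed by
-- k a j b k y = a k j k b y = a j k j b y, where a and b commute with k.
module Submission where

open import Defs
open import Data.Fin.Base using (Fin; toℕ; fromℕ<; inject₁) renaming (zero to fzero; suc to fsuc)
open import Data.Fin.Permutation using (Permutation′; _⟨$⟩ʳ_; _⟨$⟩ˡ_; _≈_; inverseˡ; inverseʳ)
import Data.Fin.Properties as Fin
open import Data.Fin.Properties using (toℕ-injective; toℕ-fromℕ<; toℕ-inject₁; toℕ<n)
open import Data.Fin.Subset using (Subset; _∩_; _∪_) renaming (_∈_ to _∈ₛ_; _⊆_ to _⊆ₛ_)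
open import Data.Fin.Subset.Properties
  using (p∩q⊆p; p∩q⊆q; x∈p∩q⁺; p⊆p∪q; q⊆p∪q; x∈p∪q⁻; ∩-distribˡ-∪)
  renaming (⊆-antisym to ⊆ₛ-antisym; _∈?_ to _∈ₛ?_)
open import Data.List.Base using (List; []; _∷_; _++_; length; map; lookup; filter)
open import Data.List.Membership.Propositional using (_∈_; _∉_; find)
open import Data.List.Membership.Propositional.Properties
  using (∈-++⁺ˡ; ∈-++⁺ʳ; ∈-++⁻; ∈-∃++; ∈-map⁺; ∈-map⁻; ∈-filter⁺; ∈-filter⁻; ∈-lookup)
open import Data.List.Properties using (length-++; ++-assoc)
open import Data.List.Relation.Binary.Sublist.Propositional
  using (_⊆_; []; _∷_; _∷ʳ_; ⊆-refl; ⊆-trans; minimum; from∈; to∈) renaming (lookup to ⊆-lookup)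
open import Data.List.Relation.Binary.Sublist.Propositional.Properties
  using (length-mono-≤; ++⁺ˡ; ++⁺; All-resp-⊆; filter-⊆)
open import Data.List.Relation.Unary.All as All using (All; []; _∷_)
open import Data.List.Relation.Unary.All.Properties using (¬Any⇒All¬; All¬⇒¬Any)
open import Data.List.Relation.Unary.Any using (here; there; any?; index)
open import Data.List.Relation.Unary.Any.Properties using (lookup-index)
open import Data.List.Relation.Unary.Unique.Propositional using (Unique; []; _∷_)
import Data.List.Relation.Unary.Unique.Propositional.Properties as Unique
open import Data.Nat.Base using (ℕ; zero; suc; _+_; _≤_; _<_; z≤n; s≤s; s≤s⁻¹)
open import Data.Nat.Properties
  using (_≟_; _<?_; _≤?_; ≤-refl; ≤-reflexive; ≤-trans; ≤-antisym; <⇒≤; <⇒≢; ≮⇒≥; ≰⇒>; ≤∧≢⇒<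
        ; <-irrefl; ≤-<-trans; <-≤-trans; m≤n⇒m<n∨m≡n; n≤1+n; m≤n+m; m≤m+n; +-monoˡ-≤; +-monoʳ-≤
        ; +-mono-≤; +-cancelʳ-≤; 1+n≢n; suc-injective; +-commutativeSemigroup)
open import Algebra.Properties.CommutativeSemigroup +-commutativeSemigroup using (x∙yz≈y∙xz)
open import Data.Nat.Tactic.RingSolver using (solve-∀)
open import Data.Product.Base using (∃; _×_; _,_; proj₁; proj₂)
open import Data.Sum.Base using (_⊎_; inj₁; inj₂; [_,_]′)
open import Data.Sum.Properties using (inj₁-injective; inj₂-injective; ≡-dec)
open import Data.Vec.Base using (tabulate)
open import Data.Vec.Properties using (lookup⇒[]=; []=⇒lookup; lookup∘tabulate)
open import Function.Base using (_∘_; id)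
open import Function.Bundles using (_⇔_; mk⇔)
open import Function.Definitions using (Injective)
open import Relation.Binary.Bundles.Raw using (RawRelation)
open import Relation.Binary.Lattice.Structures using (IsLattice; IsDistributiveLattice)
open import Relation.Binary.Morphism.Structures using (IsOrderIsomorphism)
open import Relation.Binary.PropositionalEquality.Core
  using (_≡_; _≢_; _≗_; refl; sym; trans; cong; cong₂; subst; subst₂)
open import Relation.Nullary.Decidable using (Dec; yes; no; does; _⊎-dec_; _×-dec_; dec-true)
open import Relation.Nullary.Negation.Core using (¬_; contradiction)

private
  variable
    m : ℕ
    i j k : Fin m
    s t u x y x₁ y₁ x₂ y₂ : Word m
    v w : 𝔖 m

infix 4 _~_ _⊴_ _≋_ _⊑_ _spells_


-- Adjacent transpositions of the natural numbers

_~_ : ℕ → ℕ → Set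
a ~ b = suc a ≡ b ⊎ a ≡ suc b

~-sym : ∀ {a b} → a ~ b → b ~ a
~-sym (inj₁ e) = inj₂ (sym e)
~-sym (inj₂ e) = inj₁ (sym e)

~-irrefl : ∀ {a} → ¬ a ~ a
~-irrefl (inj₁ e) = 1+n≢n e
~-irrefl (inj₂ e) = 1+n≢n (sym e)

-- Acting on all of ℕ avoids bounds, and the recursion on both arguments reduces the Coxeter
-- relations to computations near 0.
swap : ℕ → ℕ → ℕ
swap zero    zero          = 1
swap zero    (suc zero)    = 0
swap zero    (suc (suc v)) = suc (suc v)
swap (suc i) zero          = zero
swap (suc i) (suc v)       = suc (swap i v)

swap-left : ∀ i → swap i i ≡ suc i
swap-left zero    = refl
swap-left (suc i) = cong suc (swap-left i)

swap-right : ∀ i → swap i (suc i) ≡ i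
swap-right zero    = refl
swap-right (suc i) = cong suc (swap-right i)

swap-fix : ∀ i v → v ≢ i → v ≢ suc i → swap i v ≡ v
swap-fix zero    zero          p q = contradiction refl p
swap-fix zero    (suc zero)    p q = contradiction refl q
swap-fix zero    (suc (suc v)) p q = refl
swap-fix (suc i) zero          p q = refl
swap-fix (suc i) (suc v)       p q = cong suc (swap-fix i v (p ∘ cong suc) (q ∘ cong suc))

swap-involutive : ∀ i v → swap i (swap i v) ≡ v
swap-involutive zero    zero          = refl
swap-involutive zero    (suc zero)    = refl
swap-involutive zero    (suc (suc v)) = refl
swap-involutive (suc i) zero          = refl
swap-involutive (suc i) (suc v)       = cong suc (swap-involutive i v)

swap-injective : ∀ i → Injective _≡_ _≡_ (swap i)
swap-injective i {a} {b} e =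
  trans (sym (swap-involutive i a)) (trans (cong (swap i) e) (swap-involutive i b))

swap-comm : ∀ i j → ¬ i ~ j → ∀ v → swap i (swap j v) ≡ swap j (swap i v)
swap-comm zero    zero          _ v             = refl
swap-comm zero    (suc zero)    n v             = contradiction (inj₁ refl) n
swap-comm zero    (suc (suc j)) _ zero          = refl
swap-comm zero    (suc (suc j)) _ (suc zero)    = refl
swap-comm zero    (suc (suc j)) _ (suc (suc v)) = refl
swap-comm (suc zero)    zero    n v             = contradiction (inj₂ refl) n
swap-comm (suc (suc i)) zero    _ zero          = refl
swap-comm (suc (suc i)) zero    _ (suc zero)    = refl
swap-comm (suc (suc i)) zero    _ (suc (suc v)) = refl
swap-comm (suc i) (suc j) _ zero    = refl
swap-comm (suc i) (suc j) n (suc v) =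
  cong suc (swap-comm i j (λ { (inj₁ e) → n (inj₁ (cong suc e)) ; (inj₂ e) → n (inj₂ (cong suc e)) }) v)

swap-braid : ∀ i j → i ~ j → ∀ v → swap i (swap j (swap i v)) ≡ swap j (swap i (swap j v))
swap-braid i .(suc i) (inj₁ refl) = braid i
  where
  braid : ∀ i v → swap i (swap (suc i) (swap i v)) ≡ swap (suc i) (swap i (swap (suc i) v))
  braid zero    zero                = refl
  braid zero    (suc zero)          = refl
  braid zero    (suc (suc zero))    = refl
  braid zero    (suc (suc (suc v))) = refl
  braid (suc i) zero                = refl
  braid (suc i) (suc v)             = cong suc (braid i v)
swap-braid .(suc j) j (inj₂ refl) v = sym (swap-braid j (suc j) (inj₁ refl) v)

-- For j = i + 1 the two products already differ at i, which they take to i + 1 and to i + 2.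
swap-noncomm : ∀ i j → i ~ j → ¬ (∀ v → swap i (swap j v) ≡ swap j (swap i v))
swap-noncomm i .(suc i) (inj₁ refl) h = lemma i (h i)
  where
  lemma : ∀ i → swap i (swap (suc i) i) ≢ swap (suc i) (swap i i)
  lemma zero    ()
  lemma (suc i) e = lemma i (suc-injective e)
swap-noncomm .(suc j) j (inj₂ refl) h = swap-noncomm j (suc j) (inj₁ refl) (λ v → sym (h v))

-- In terms of words: i is an ascent of k i, which makes i k i reduced.
swap-ascent-conj : ∀ i k → i ~ k → swap i (swap k i) < swap i (swap k (suc i))
swap-ascent-conj zero          .1    (inj₁ refl) = s≤s (s≤s z≤n)
swap-ascent-conj (suc zero)    .2    (inj₁ refl) = s≤s (s≤s (s≤s z≤n))
swap-ascent-conj (suc (suc i)) .(suc (suc (suc i))) (inj₁ refl) =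
  s≤s (swap-ascent-conj (suc i) (suc (suc i)) (inj₁ refl))
swap-ascent-conj .1 zero (inj₂ refl) = s≤s z≤n
swap-ascent-conj .(suc (suc k)) (suc k) (inj₂ refl) = s≤s (swap-ascent-conj (suc k) k (inj₂ refl))

-- Rank matrices, built from the indicator `χ j a` of j ≤ a

χ : ℕ → ℕ → ℕ
χ zero    a       = 1
χ (suc j) zero    = 0
χ (suc j) (suc a) = χ j a

χ≤1 : ∀ j a → χ j a ≤ 1
χ≤1 zero    a       = ≤-refl
χ≤1 (suc j) zero    = z≤n
χ≤1 (suc j) (suc a) = χ≤1 j a

χ-mono : ∀ j {a b} → a ≤ b → χ j a ≤ χ j b
χ-mono zero    p       = ≤-refl
χ-mono (suc j) z≤n     = z≤n
χ-mono (suc j) (s≤s p) = χ-mono j p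

χ-cancel : ∀ {a b} → (∀ j → χ j a ≤ χ j b) → a ≤ b
χ-cancel {zero}          h = z≤n
χ-cancel {suc a} {zero}  h = contradiction (h 1) (λ ())
χ-cancel {suc a} {suc b} h = s≤s (χ-cancel (h ∘ suc))

-- The rank matrix of p; by the two ⊴-swap lemmas its entrywise order is the Bruhat order.
rank : (ℕ → ℕ) → ℕ → ℕ → ℕ
rank p zero    j = 0
rank p (suc i) j = χ j (p i) + rank p i j

_⊴_ : (ℕ → ℕ) → (ℕ → ℕ) → Set
p ⊴ q = ∀ i j → rank p i j ≤ rank q i j

rank-cong : ∀ {p q} → p ≗ q → ∀ i j → rank p i j ≡ rank q i j
rank-cong e zero    j = refl
rank-cong e (suc i) j = cong₂ _+_ (cong (χ j) (e i)) (rank-cong e i j)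

⊴-reflexive : ∀ {p q} → p ≗ q → p ⊴ q
⊴-reflexive e i j = ≤-reflexive (rank-cong e i j)

⊴-trans : ∀ {p q r} → p ⊴ q → q ⊴ r → p ⊴ r
⊴-trans f g i j = ≤-trans (f i j) (g i j)

-- Consecutive rows of a rank matrix differ by `χ j (p v)`. Comparing rows v + 1 one way and rows v
-- the other way gives `χ j (p v) ≤ χ j (q v)` for every j, hence `p v ≤ q v`.
⊴-antisym : ∀ {p q} → p ⊴ q → q ⊴ p → p ≗ q
⊴-antisym f g v = ≤-antisym (half f g) (half g f)
  where
  half : ∀ {p q} → p ⊴ q → q ⊴ p → p v ≤ q v
  half {p} {q} f g = χ-cancel λ j → +-cancelʳ-≤ (rank p v j) _ _
    (≤-trans (f (suc v) j) (+-monoʳ-≤ (χ j (q v)) (g v j)))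

module _ (p : ℕ → ℕ) (i : ℕ) where

  rank-swap-below : ∀ v j → v ≤ i → rank (p ∘ swap i) v j ≡ rank p v j
  rank-swap-below zero    j _   = refl
  rank-swap-below (suc v) j v<i = cong₂ _+_
    (cong (χ j ∘ p) (swap-fix i v (<⇒≢ v<i) (<⇒≢ (≤-trans v<i (n≤1+n i)))))
    (rank-swap-below v j (<⇒≤ v<i))

  rank-swap-at : ∀ j → rank (p ∘ swap i) (suc i) j ≡ χ j (p (suc i)) + rank p i j
  rank-swap-at j = cong₂ _+_ (cong (χ j ∘ p) (swap-left i)) (rank-swap-below i j ≤-refl)

  -- Rows up to i count neither of the exchanged entries and rows from i + 2 on count both, so only
  -- row i + 1 can change.
  rank-swap-other : ∀ v j → v ≢ suc i → rank (p ∘ swap i) v j ≡ rank p v j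
  rank-swap-other zero    j _ = refl
  rank-swap-other (suc v) j n with v ≟ suc i
  ... | yes refl = trans
    (cong₂ _+_ (cong (χ j ∘ p) (swap-right i)) (rank-swap-at j))
    (x∙yz≈y∙xz (χ j (p i)) (χ j (p (suc i))) (rank p i j))
  ... | no v≢1+i = cong₂ _+_
    (cong (χ j ∘ p) (swap-fix i v (n ∘ cong suc) v≢1+i))
    (rank-swap-other v j v≢1+i)

-- At a descent of q the row suc i of its rank matrix is the largest one compatible with the two
-- neighbouring rows; at an ascent of p it is the smallest one.
⊴-swapˡ : ∀ {p q} i → q (suc i) ≤ q i → p ⊴ q → p ∘ swap i ⊴ q
⊴-swapˡ {p} {q} i desc f v j with v ≟ suc i
... | no n     = ≤-trans (≤-reflexive (rank-swap-other p i v j n)) (f v j)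
... | yes refl = ≤-trans (≤-reflexive (rank-swap-at p i j))
  (largest (χ≤1 j _) (χ-mono j desc)
    (+-mono-≤ (χ≤1 j _) (f i j))
    (≤-trans (+-monoʳ-≤ (χ j (p (suc i))) (m≤n+m _ (χ j (p i)))) (f (suc (suc i)) j)))
  where
  -- `x` and `y` are the indicators for q at i and i + 1, and `B` is the entry to be bounded. If `x`
  -- is 0, so is `y`, and row i + 2 gives the bound; if `x` is 1, row i does.
  largest : ∀ {x y a B} → x ≤ 1 → y ≤ x → B ≤ suc a → B ≤ y + (x + a) → B ≤ x + a
  largest z≤n       z≤n _ h = h
  largest (s≤s z≤n) _   h _ = h

⊴-swapʳ : ∀ {p q} i → p i ≤ p (suc i) → p ⊴ q → p ⊴ q ∘ swap i
⊴-swapʳ {p} {q} i asc f v j with v ≟ suc i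
... | no n     = ≤-trans (f v j) (≤-reflexive (sym (rank-swap-other q i v j n)))
... | yes refl = ≤-trans
  (smallest (χ≤1 j _) (χ-mono j asc)
    (≤-trans (f i j) (m≤n+m _ (χ j (q (suc i)))))
    (≤-trans (f (suc (suc i)) j)
      (≤-trans (≤-reflexive (x∙yz≈y∙xz (χ j (q (suc i))) (χ j (q i)) (rank q i j)))
               (+-monoˡ-≤ _ (χ≤1 j (q i))))))
  (≤-reflexive (sym (rank-swap-at q i j)))
  where
  -- Dually, with the indicators for p: if `x` is 0, row i gives the bound; otherwise both are 1 and
  -- row i + 2 does.
  smallest : ∀ {x y a B} → y ≤ 1 → x ≤ y → a ≤ B → y + (x + a) ≤ suc B → x + a ≤ B
  smallest _         z≤n       h _ = h
  smallest (s≤s z≤n) (s≤s z≤n) _ h = s≤s⁻¹ h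

-- Words and reduced words

rank-diagonal : ∀ n {j} → n ≤ j → rank id n j ≡ 0
rank-diagonal zero    _         = refl
rank-diagonal (suc n) (s≤s n≤j) =
  cong₂ _+_ (χ-above (s≤s n≤j)) (rank-diagonal n (≤-trans n≤j (n≤1+n _)))
  where
  χ-above : ∀ {a j} → a < j → χ j a ≡ 0
  χ-above {zero}  (s≤s _)  = refl
  χ-above {suc a} (s≤s lt) = χ-above lt

-- If v < p v, the entry at (v + 1, v + 1) is positive for p but zero for the identity. So p v ≤ v
-- throughout, and by strong induction p v < v would contradict injectivity, p v being fixed
-- already.
⊴-id⇒≗id : ∀ {p} → Injective _≡_ _≡_ p → p ⊴ id → p ≗ id
⊴-id⇒≗id {p} inj f v = fixed (suc v) v ≤-refl
  where
  χ-below : ∀ {a j} → j ≤ a → χ j a ≡ 1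
  χ-below z≤n     = refl
  χ-below (s≤s l) = χ-below l

  decreasing : ∀ v → p v ≤ v
  decreasing v = ≮⇒≥ λ v<pv → contradiction
    (≤-trans (≤-trans (≤-reflexive (sym (χ-below v<pv))) (m≤m+n _ _))
      (≤-trans (f (suc v) (suc v)) (≤-reflexive (rank-diagonal (suc v) ≤-refl))))
    (λ ())

  fixed : ∀ n v → v < n → p v ≡ v
  fixed (suc n) v (s≤s v≤n) with m≤n⇒m<n∨m≡n (decreasing v)
  ... | inj₂ e    = e
  ... | inj₁ pv<v = contradiction (inj (fixed n (p v) (<-≤-trans pv<v v≤n))) (<⇒≢ pv<v)

⊆∧length≥⇒≡ : ∀ {a} {A : Set a} {xs ys : List A} → xs ⊆ ys → length ys ≤ length xs → xs ≡ ys
⊆∧length≥⇒≡ []         _       = refl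
⊆∧length≥⇒≡ (y ∷ʳ τ)   h       = contradiction (<-≤-trans h (length-mono-≤ τ)) (<-irrefl refl)
⊆∧length≥⇒≡ (refl ∷ τ) (s≤s h) = cong (_ ∷_) (⊆∧length≥⇒≡ τ h)

-- The inverse of ⟦ s ⟧, extended to ℕ by fixing every v > m.
pos : Word m → ℕ → ℕ
pos []      v = v
pos (i ∷ s) v = pos s (swap (toℕ i) v)

pos-++ : ∀ (s : Word m) t v → pos (s ++ t) v ≡ pos t (pos s v)
pos-++ []      t v = refl
pos-++ (i ∷ s) t v = pos-++ s t (swap (toℕ i) v)

pos-injective : ∀ (s : Word m) → Injective _≡_ _≡_ (pos s)
pos-injective []      e = e
pos-injective (i ∷ s) e = swap-injective (toℕ i) (pos-injective s e)

-- A record, as is `_⊑_`, so that the two words can be inferred from a proof; they cannot be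
-- recovered from `pos s` and `pos t`.
record _≋_ {m} (s t : Word m) : Set where
  constructor ≗⇒≋
  field ≋⇒≗ : pos s ≗ pos t

record _⊑_ {m} (s t : Word m) : Set where
  constructor ⊴⇒⊑
  field ⊑⇒⊴ : pos s ⊴ pos t

open _≋_
open _⊑_

≋-refl : s ≋ s
≋-refl = ≗⇒≋ λ _ → refl

≋-sym : s ≋ t → t ≋ s
≋-sym (≗⇒≋ e) = ≗⇒≋ λ v → sym (e v)

≋-trans : s ≋ t → t ≋ u → s ≋ u
≋-trans (≗⇒≋ e) (≗⇒≋ f) = ≗⇒≋ λ v → trans (e v) (f v)

≋-reflexive : s ≡ t → s ≋ t
≋-reflexive refl = ≋-refl

⊑-refl : s ⊑ s
⊑-refl = ⊴⇒⊑ λ _ _ → ≤-refl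

⊑-trans : s ⊑ t → t ⊑ u → s ⊑ u
⊑-trans (⊴⇒⊑ f) (⊴⇒⊑ g) = ⊴⇒⊑ (⊴-trans f g)

⊑-antisym : s ⊑ t → t ⊑ s → s ≋ t
⊑-antisym (⊴⇒⊑ f) (⊴⇒⊑ g) = ≗⇒≋ (⊴-antisym f g)

≋⇒⊑ : s ≋ t → s ⊑ t
≋⇒⊑ (≗⇒≋ e) = ⊴⇒⊑ (⊴-reflexive e)

≋-∷ : ∀ (i : Fin m) → s ≋ t → i ∷ s ≋ i ∷ t
≋-∷ i (≗⇒≋ e) = ≗⇒≋ λ v → e (swap (toℕ i) v)

≋-++ˡ : ∀ (x : Word m) → s ≋ t → x ++ s ≋ x ++ t
≋-++ˡ []      e = e
≋-++ˡ (i ∷ x) e = ≋-∷ i (≋-++ˡ x e)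

≋-++ʳ : ∀ (s : Word m) → x ≋ y → x ++ s ≋ y ++ s
≋-++ʳ {x = x} {y} s (≗⇒≋ e) = ≗⇒≋ λ v →
  trans (pos-++ x s v) (trans (cong (pos s) (e v)) (sym (pos-++ y s v)))

∷∷-cancel : ∀ (i : Fin m) s → i ∷ i ∷ s ≋ s
∷∷-cancel i s = ≗⇒≋ λ v → cong (pos s) (swap-involutive (toℕ i) v)

-- As `pos s` is the inverse permutation, this compares the places of the values i and i + 1. It is
-- the criterion for the letter i to lengthen a reduced word when put in front.
Ascent : Word m → Fin m → Set
Ascent s i = pos s (toℕ i) < pos s (suc (toℕ i))

-- Equivalent to having minimal length, by Red-minimal and minimal⇒Red.
data Red {m} : Word m → Set where
  []  : Red []
  _∷_ : Ascent s i → Red s → Red (i ∷ s)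

Red-++⁻ʳ : ∀ (x : Word m) → Red (x ++ s) → Red s
Red-++⁻ʳ []      r       = r
Red-++⁻ʳ (i ∷ x) (_ ∷ r) = Red-++⁻ʳ x r

Ascent-cong : s ≋ t → Ascent s i → Ascent t i
Ascent-cong {i = i} (≗⇒≋ e) = subst₂ _<_ (e (toℕ i)) (e (suc (toℕ i)))

Red-∷-cong : s ≋ t → Red t → Red (i ∷ s) → Red (i ∷ t)
Red-∷-cong {i = i} e r (a ∷ _) = Ascent-cong {i = i} e a ∷ r

∷-descent : ∀ (s : Word m) i → Ascent s i → pos (i ∷ s) (suc (toℕ i)) ≤ pos (i ∷ s) (toℕ i)
∷-descent s i a = subst₂ _≤_
  (cong (pos s) (sym (swap-right (toℕ i)))) (cong (pos s) (sym (swap-left (toℕ i)))) (<⇒≤ a)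

⊑-∷ : Ascent t i → t ⊑ i ∷ t
⊑-∷ {i = i} a = ⊴⇒⊑ (⊴-swapʳ (toℕ i) (<⇒≤ a) λ _ _ → ≤-refl)

-- Half of the lifting property of the Bruhat order. It is used to turn a failed ascent into further
-- elements below `t`.
descent-lift : ¬ Ascent t i → s ⊑ t → i ∷ s ⊑ t
descent-lift {i = i} n (⊴⇒⊑ f) = ⊴⇒⊑ (⊴-swapˡ (toℕ i) (≮⇒≥ n) f)

-- The easy half of the subword property. Where the first letter i is kept, `i ∷ t` has a descent at
-- i, and the rest of `s`, lying below `i ∷ t`, can be lifted there.
⊆⇒⊑ : Red t → s ⊆ t → s ⊑ t
⊆⇒⊑ {t = []}    _       []         = ⊑-refl
⊆⇒⊑ {t = i ∷ t} (a ∷ r) (_ ∷ʳ τ)   = ⊑-trans (⊆⇒⊑ r τ) (⊑-∷ a)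
⊆⇒⊑ {t = i ∷ t} (a ∷ r) (refl ∷ τ) =
  ⊴⇒⊑ (⊴-swapˡ (toℕ i) (∷-descent t i a) (⊑⇒⊴ (⊑-trans (⊆⇒⊑ r τ) (⊑-∷ a))))

-- The hard half of the subword property, by recursion on `t`. Its first letter i is dropped if p
-- goes up at i; otherwise it is kept and the recursion continues with `p ∘ swap (toℕ i)`.
subword-of-⊴ : ∀ {p} → Red t → Injective _≡_ _≡_ p → p ⊴ pos t → ∃ λ s → s ⊆ t × Red s × pos s ≗ p
subword-of-⊴ {t = []}        []      inj f = [] , [] , [] , λ v → sym (⊴-id⇒≗id inj f v)
subword-of-⊴ {t = i ∷ t} {p} (a ∷ r) inj f with p (toℕ i) <? p (suc (toℕ i))
... | yes asc =
  let s , τ , rs , e = subword-of-⊴ r inj (⊴-trans (⊴-swapʳ (toℕ i) (<⇒≤ asc) f)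
                         (⊴-reflexive (cong (pos t) ∘ swap-involutive (toℕ i))))
  in s , i ∷ʳ τ , rs , e
... | no ¬asc =
  let s , τ , rs , e = subword-of-⊴ r (swap-injective (toℕ i) ∘ inj) below
  in i ∷ s , refl ∷ τ , subst₂ _<_ (sym (e (toℕ i))) (sym (e (suc (toℕ i)))) asc′ ∷ rs
   , λ v → trans (e (swap (toℕ i) v)) (cong p (swap-involutive (toℕ i) v))
  where
  desc : p (suc (toℕ i)) < p (toℕ i)
  desc = ≤∧≢⇒< (≮⇒≥ ¬asc) (1+n≢n ∘ inj)
  asc′ : p (swap (toℕ i) (toℕ i)) < p (swap (toℕ i) (suc (toℕ i)))
  asc′ = subst₂ _<_ (cong p (sym (swap-left (toℕ i)))) (cong p (sym (swap-right (toℕ i)))) desc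
  -- At a descent `p ∘ swap (toℕ i)` lies below p, hence below `pos (i ∷ t)`. As it goes up at i,
  -- the letter i can also be cancelled on the right.
  below : p ∘ swap (toℕ i) ⊴ pos t
  below = ⊴-trans
    (⊴-swapʳ (toℕ i) (<⇒≤ asc′)
      (⊴-trans (⊴-swapˡ (toℕ i) (<⇒≤ desc) (⊴-reflexive λ _ → refl)) f))
    (⊴-reflexive (cong (pos t) ∘ swap-involutive (toℕ i)))

⊑⇒subword : Red t → s ⊑ t → ∃ λ s′ → s′ ⊆ t × Red s′ × s′ ≋ s
⊑⇒subword {s = s} r (⊴⇒⊑ f) =
  let s′ , τ , r′ , e = subword-of-⊴ r (pos-injective s) f
  in s′ , τ , r′ , ≗⇒≋ e

-- Lifting `t ⊑ t` gives `i ∷ t ⊑ t`, and the subword property then finds the permutation of `i ∷ t`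
-- inside `t`.
exchange : Red t → ¬ Ascent t i → ∃ λ s → s ⊆ t × length s < length t × Red s × s ≋ i ∷ t
exchange {t = t} {i} r n =
  let s , τ , rs , e = ⊑⇒subword r (descent-lift {i = i} n ⊑-refl)
  in s , τ , shorter τ e , rs , e
  where
  shorter : ∀ {s} → s ⊆ t → s ≋ i ∷ t → length s < length t
  shorter τ (≗⇒≋ e) with m≤n⇒m<n∨m≡n (length-mono-≤ τ)
  ... | inj₁ lt = lt
  -- Equal lengths would make the subword all of `t`, so that the letter i would not change the
  -- permutation.
  ... | inj₂ eq with refl ← ⊆∧length≥⇒≡ τ (≤-reflexive (sym eq)) =
    contradiction (pos-injective t (trans (e (toℕ i)) (cong (pos t) (swap-left (toℕ i))))) (1+n≢n ∘ sym)

reduce : ∀ (s : Word m) → ∃ λ s′ → s′ ⊆ s × Red s′ × s′ ≋ s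
reduce []      = [] , [] , [] , ≋-refl
reduce (i ∷ s) with reduce s
... | s₁ , τ₁ , r₁ , e₁ with pos s₁ (toℕ i) <? pos s₁ (suc (toℕ i))
... | yes asc = i ∷ s₁ , refl ∷ τ₁ , asc ∷ r₁ , ≋-∷ i e₁
... | no ¬asc with exchange {i = i} r₁ ¬asc
... | s₂ , τ₂ , _ , r₂ , e₂ =
  s₂ , i ∷ʳ ⊆-trans τ₂ τ₁ , r₂ , ≋-trans e₂ (≋-∷ i e₁)

-- Induction on `s`: its first letter i is a descent of `t` too, so an exchange yields a shorter
-- reduced word for the tail of `s`.
Red-length : Red s → Red t → s ≋ t → length s ≤ length t
Red-length {s = []}    _       _  _ = z≤n
Red-length {s = i ∷ s} {t = t} (a ∷ r) rt e =
  let t₁ , τ , lt , r₁ , e₁ = exchange {i = i} rt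
        (λ asc → <-irrefl refl (<-≤-trans (Ascent-cong {i = i} (≋-sym e) asc) (∷-descent s i a)))
  in ≤-trans (s≤s (Red-length r r₁
       (≋-sym (≋-trans e₁ (≋-trans (≋-∷ i (≋-sym e)) (∷∷-cancel i s)))))) lt

Red-minimal : Red s → ∀ t → s ≋ t → length s ≤ length t
Red-minimal r t e =
  let t₁ , τ , r₁ , e₁ = reduce t
  in ≤-trans (Red-length r r₁ (≋-trans e (≋-sym e₁))) (length-mono-≤ τ)

minimal⇒Red : (∀ t → s ≋ t → length s ≤ length t) → Red s
minimal⇒Red {s = s} h =
  let s₁ , τ , r₁ , e₁ = reduce s
  in subst Red (⊆∧length≥⇒≡ τ (h s₁ (≋-sym e₁))) r₁

Red-≋ : Red t → s ≋ t → length s ≤ length t → Red s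
Red-≋ r e h = minimal⇒Red λ u f → ≤-trans h (Red-minimal r u (≋-trans (≋-sym e) f))

⊑-length : Red s → Red t → s ⊑ t → length s ≤ length t
⊑-length rs rt f =
  let s₁ , τ , r₁ , e₁ = ⊑⇒subword rt f
  in ≤-trans (Red-length rs r₁ (≋-sym e₁)) (length-mono-≤ τ)

⊑∧length≥⇒≋ : Red s → Red t → s ⊑ t → length t ≤ length s → s ≋ t
⊑∧length≥⇒≋ rs rt f h =
  let s₁ , τ , r₁ , e₁ = ⊑⇒subword rt f
  in ≋-trans (≋-sym e₁)
       (≋-reflexive (⊆∧length≥⇒≡ τ (≤-trans h (Red-length rs r₁ (≋-sym e₁)))))

Red-[-] : Red (i ∷ [])
Red-[-] = ≤-refl ∷ []

[i]≋[j]⇒i≡j : i ∷ [] ≋ j ∷ [] → i ≡ j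
[i]≋[j]⇒i≡j {i = i} {j} (≗⇒≋ e) = toℕ-injective (lemma (toℕ i) (toℕ j) e)
  where
  lemma : ∀ a b → swap a ≗ swap b → a ≡ b
  lemma zero    zero          _ = refl
  lemma zero    (suc b)       e with () ← e 0
  lemma (suc a) zero          e with () ← e 0
  lemma (suc a) (suc b)       e = cong suc (lemma a b (λ v → suc-injective (e (suc v))))

Red-≋[-] : Red s → s ≋ i ∷ [] → s ≡ i ∷ []
Red-≋[-] {s = []} {i} _ (≗⇒≋ e) = contradiction (sym (trans (e (toℕ i)) (swap-left (toℕ i)))) 1+n≢n
Red-≋[-] {s = j ∷ []} _ e = cong (_∷ []) ([i]≋[j]⇒i≡j e)
Red-≋[-] {s = _ ∷ _ ∷ _} r e with s≤s () ← Red-length r Red-[-] e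

[i]⊑⇒∈ : Red t → i ∷ [] ⊑ t → i ∈ t
[i]⊑⇒∈ r f =
  let s , τ , rs , e = ⊑⇒subword r f
  in to∈ (subst (_⊆ _) (Red-≋[-] rs e) τ)

∈⇒[i]⊑ : Red t → i ∈ t → i ∷ [] ⊑ t
∈⇒[i]⊑ r p = ⊆⇒⊑ r (from∈ p)

-- A letter occurs in a reduced word exactly when its generator lies below the word, so transitivity
-- suffices.
∈-resp-⊑ : Red s → Red t → s ⊑ t → i ∈ s → i ∈ t
∈-resp-⊑ rs rt f p = [i]⊑⇒∈ rt (⊑-trans (∈⇒[i]⊑ rs p) f)

-- Were i not an ascent, lifting the empty word would put the generator i below `t`, and i would
-- occur in `t`.
∷⁺-Red : Red t → i ∉ t → Red (i ∷ t)
∷⁺-Red {t = t} {i} r i∉t with pos t (toℕ i) <? pos t (suc (toℕ i))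
... | yes asc = asc ∷ r
... | no ¬asc = contradiction ([i]⊑⇒∈ r (descent-lift {i = i} ¬asc (⊆⇒⊑ r (minimum t)))) i∉t

Unique⇒Red : Unique s → Red s
Unique⇒Red []       = []
Unique⇒Red (p ∷ us) = ∷⁺-Red (Unique⇒Red us) (All¬⇒¬Any p)

-- Reduced words and the Bruhat order of 𝔖ₙ

toℕ-σ : ∀ (i : Fin m) a → toℕ (σ i ⟨$⟩ˡ a) ≡ swap (toℕ i) (toℕ a)
toℕ-σ i a with a Fin.≟ fsuc i
... | yes refl = trans (toℕ-inject₁ i) (sym (swap-right (toℕ i)))
... | no a≢1+i with a Fin.≟ inject₁ i
...   | yes refl = sym (trans (cong (swap (toℕ i)) (toℕ-inject₁ i)) (swap-left (toℕ i)))
...   | no a≢i = sym (swap-fix (toℕ i) (toℕ a)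
          (λ e → a≢i (toℕ-injective (trans e (sym (toℕ-inject₁ i)))))
          (λ e → a≢1+i (toℕ-injective e)))

pos-⟦⟧ : ∀ (s : Word m) a → pos s (toℕ a) ≡ toℕ (⟦ s ⟧ ⟨$⟩ˡ a)
pos-⟦⟧ []      a = refl
pos-⟦⟧ (i ∷ s) a = trans (cong (pos s) (sym (toℕ-σ i a))) (pos-⟦⟧ s (σ i ⟨$⟩ˡ a))

pos-outside : ∀ (s : Word m) n → m < n → pos s n ≡ n
pos-outside []      n _   = refl
pos-outside (i ∷ s) n m<n = trans
  (cong (pos s) (swap-fix (toℕ i) n
    (λ e → <-irrefl (sym e) (<-≤-trans (toℕ<n i) (<⇒≤ m<n)))
    (λ e → <-irrefl (sym e) (≤-<-trans (toℕ<n i) m<n))))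
  (pos-outside s n m<n)

≈⇒from : ∀ {n} (π ρ : Permutation′ n) → π ≈ ρ → ∀ a → π ⟨$⟩ˡ a ≡ ρ ⟨$⟩ˡ a
≈⇒from π ρ e a = trans (sym (inverseˡ ρ)) (cong (ρ ⟨$⟩ˡ_) (trans (sym (e _)) (inverseʳ π)))

from⇒≈ : ∀ {n} (π ρ : Permutation′ n) → (∀ a → π ⟨$⟩ˡ a ≡ ρ ⟨$⟩ˡ a) → π ≈ ρ
from⇒≈ π ρ e a = trans (sym (inverseʳ ρ)) (cong (ρ ⟨$⟩ʳ_) (trans (sym (e _)) (inverseˡ π)))

≈⇒≋ : ⟦ s ⟧ ≈ ⟦ t ⟧ → s ≋ t
≈⇒≋ {m} {s} {t} e = ≗⇒≋ agree
  where
  agree : ∀ n → pos s n ≡ pos t n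
  agree n with n <? suc m
  ... | no n≮1+m = trans (pos-outside s n (≮⇒≥ n≮1+m)) (sym (pos-outside t n (≮⇒≥ n≮1+m)))
  ... | yes n<1+m = subst (λ z → pos s z ≡ pos t z) (toℕ-fromℕ< n<1+m)
    (trans (pos-⟦⟧ s a) (trans (cong toℕ (≈⇒from ⟦ s ⟧ ⟦ t ⟧ e a)) (sym (pos-⟦⟧ t a))))
    where a = fromℕ< n<1+m

≋⇒≈ : s ≋ t → ⟦ s ⟧ ≈ ⟦ t ⟧
≋⇒≈ {s = s} {t} (≗⇒≋ e) = from⇒≈ ⟦ s ⟧ ⟦ t ⟧ λ a →
  toℕ-injective (trans (sym (pos-⟦⟧ s a)) (trans (e (toℕ a)) (pos-⟦⟧ t a)))

-- The working form of `_∈R_`, with the recursive `Red` in place of minimal length.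
record _spells_ {m} (s : Word m) (w : 𝔖 m) : Set where
  constructor spelling
  field
    red   : Red s
    value : ⟦ s ⟧ ≈ w

open _spells_

∈R⇒spells : ∀ s (w : 𝔖 m) → s ∈R w → s spells w
∈R⇒spells s w (e , h) = spelling (minimal⇒Red λ t f → h t (λ a → trans (sym (≋⇒≈ f a)) (e a))) e

spells⇒∈R : s spells w → s ∈R w
spells⇒∈R (spelling r e) = e , λ t f → Red-minimal r t (≈⇒≋ λ a → trans (e a) (sym (f a)))

⟦⟧-spells : Red s → s spells ⟦ s ⟧
⟦⟧-spells r = spelling r λ _ → refl

spells-≈⇒≋ : s spells v → t spells w → v ≈ w → s ≋ t
spells-≈⇒≋ (spelling _ e) (spelling _ f) v≈w = ≈⇒≋ λ a → trans (e a) (trans (v≈w a) (sym (f a)))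

spells-≋⇒≈ : s spells v → t spells w → s ≋ t → v ≈ w
spells-≋⇒≈ (spelling _ e) (spelling _ f) s≋t a = trans (sym (e a)) (trans (≋⇒≈ s≋t a) (f a))

spells-cong : Red s → s ≋ t → t spells w → s spells w
spells-cong r e (spelling _ f) = spelling r λ a → trans (≋⇒≈ e a) (f a)

-- The words witnessing the Bruhat relation may differ from `s` and `t`, but `_⊑_` depends only on
-- the permutations.
≤ᴮ⇒⊑ : s spells v → t spells w → v ≤ᴮ w → s ⊑ t
≤ᴮ⇒⊑ {v = v} {w = w} sv tw (s′ , t′ , s′∈R , t′∈R , τ) =
  let s′v = ∈R⇒spells s′ v s′∈R
      t′w = ∈R⇒spells t′ w t′∈R
  in ⊑-trans (≋⇒⊑ (spells-≈⇒≋ sv s′v λ _ → refl))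
       (⊑-trans (⊆⇒⊑ (red t′w) τ) (≋⇒⊑ (spells-≈⇒≋ t′w tw λ _ → refl)))

-- The subword property finds a reduced word of v inside the prescribed word `t`; it serves as
-- witness in place of `s`.
⊑⇒≤ᴮ : s spells v → t spells w → s ⊑ t → v ≤ᴮ w
⊑⇒≤ᴮ {t = t} sv tw f =
  let s′ , τ , r , e = ⊑⇒subword (red tw) f
  in s′ , t , spells⇒∈R (spells-cong r e sv) , spells⇒∈R tw , τ

spelling-below : ∀ (v w : 𝔖 m) → v ≤ᴮ w → ∃ λ (s : Word m) → s spells v
spelling-below v w (s , _ , s∈R , _) = s , ∈R⇒spells s v s∈R

-- Words x k y

Adj : Fin m → Fin m → Set
Adj i j = toℕ i ~ toℕ j

adj? : ∀ (i j : Fin m) → Dec (Adj i j)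
adj? i j = (suc (toℕ i) ≟ toℕ j) ⊎-dec (toℕ i ≟ suc (toℕ j))

Adj⇒≢ : Adj i j → i ≢ j
Adj⇒≢ a refl = ~-irrefl a

∷∷-comm : ∀ s → ¬ Adj i j → i ∷ j ∷ s ≋ j ∷ i ∷ s
∷∷-comm {i = i} {j} s n = ≗⇒≋ λ v → cong (pos s) (swap-comm (toℕ j) (toℕ i) (n ∘ ~-sym) v)

∷∷∷-braid : ∀ s → Adj i j → i ∷ j ∷ i ∷ s ≋ j ∷ i ∷ j ∷ s
∷∷∷-braid {i = i} {j} s a = ≗⇒≋ λ v → cong (pos s) (swap-braid (toℕ i) (toℕ j) a v)

[ij]≋[ji]⇒¬Adj : i ∷ j ∷ [] ≋ j ∷ i ∷ [] → ¬ Adj i j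
[ij]≋[ji]⇒¬Adj {i = i} {j} (≗⇒≋ e) a = swap-noncomm (toℕ i) (toℕ j) a (λ v → sym (e v))

comm-past : ∀ {x : Word m} s → All (λ j → ¬ Adj i j) x → i ∷ x ++ s ≋ x ++ i ∷ s
comm-past s []       = ≋-refl
comm-past s (n ∷ ns) = ≋-trans (∷∷-comm _ n) (≋-∷ _ (comm-past s ns))

-- If no letter of `x` were adjacent to i, the first i could be moved past `x` and cancelled against
-- the second.
Red-between : ∀ (x : Word m) → Red (i ∷ x ++ i ∷ y) → ∃ λ j → j ∈ x × Adj i j
Red-between {i = i} {y} x r with any? (adj? i) x
... | yes p = find p
... | no ¬p = contradiction
  (≤-trans (Red-minimal r (x ++ y)
      (≋-trans (comm-past (i ∷ y) (¬Any⇒All¬ x ¬p)) (≋-++ˡ x (∷∷-cancel i y))))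
    (length-mono-≤ (++⁺ (⊆-refl {x = x}) (i ∷ʳ ⊆-refl {x = y}))))
  (<-irrefl refl)

pair-++⁻ : ∀ {a} {A : Set a} {c d : A} xs {ys} → c ∷ d ∷ [] ⊆ xs ++ ys →
  (c ∷ d ∷ [] ⊆ xs) ⊎ (c ∈ xs × d ∈ ys) ⊎ (c ∷ d ∷ [] ⊆ ys)
pair-++⁻ []       τ = inj₂ (inj₂ τ)
pair-++⁻ (e ∷ xs) (.e ∷ʳ τ) with pair-++⁻ xs τ
... | inj₁ τ′              = inj₁ (e ∷ʳ τ′)
... | inj₂ (inj₁ (p , q))  = inj₂ (inj₁ (there p , q))
... | inj₂ (inj₂ τ′)       = inj₂ (inj₂ τ′)
pair-++⁻ (e ∷ xs) (refl ∷ τ) with ∈-++⁻ xs (to∈ τ)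
... | inj₁ p = inj₁ (refl ∷ from∈ p)
... | inj₂ q = inj₂ (inj₁ (here refl , q))

Unique-resp-⊇ : ∀ {a} {A : Set a} {xs ys : List A} → xs ⊆ ys → Unique ys → Unique xs
Unique-resp-⊇ []         []       = []
Unique-resp-⊇ (_ ∷ʳ τ)   (_ ∷ us) = Unique-resp-⊇ τ us
Unique-resp-⊇ (refl ∷ τ) (p ∷ us) = All-resp-⊆ τ p ∷ Unique-resp-⊇ τ us

Unique⇒∌pair : ∀ {a} {A : Set a} {c : A} {xs} → Unique xs → ¬ c ∷ c ∷ [] ⊆ xs
Unique⇒∌pair us τ with (n ∷ []) ∷ _ ← Unique-resp-⊇ τ us = n refl

pigeonhole : ∀ {a} {A : Set a} {c d : A} {xs} → All (λ e → e ≡ c ⊎ e ≡ d) xs → 3 ≤ length xs →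
  (c ∷ c ∷ [] ⊆ xs) ⊎ (d ∷ d ∷ [] ⊆ xs)
pigeonhole (_ ∷ [])     (s≤s ())
pigeonhole (_ ∷ _ ∷ []) (s≤s (s≤s ()))
pigeonhole (inj₁ refl ∷ inj₁ refl ∷ _)             _ = inj₁ (refl ∷ refl ∷ minimum _)
pigeonhole (inj₁ refl ∷ inj₂ refl ∷ inj₁ refl ∷ _) _ = inj₁ (refl ∷ _ ∷ʳ refl ∷ minimum _)
pigeonhole (inj₁ refl ∷ inj₂ refl ∷ inj₂ refl ∷ _) _ = inj₂ (_ ∷ʳ refl ∷ refl ∷ minimum _)
pigeonhole (inj₂ refl ∷ inj₂ refl ∷ _)             _ = inj₂ (refl ∷ refl ∷ minimum _)
pigeonhole (inj₂ refl ∷ inj₁ refl ∷ inj₂ refl ∷ _) _ = inj₂ (refl ∷ _ ∷ʳ refl ∷ minimum _)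
pigeonhole (inj₂ refl ∷ inj₁ refl ∷ inj₁ refl ∷ _) _ = inj₁ (_ ∷ʳ refl ∷ refl ∷ minimum _)

Red-pair : i ≢ j → Red (i ∷ j ∷ [])
Red-pair n = Unique⇒Red ((n ∷ []) ∷ [] ∷ [])

Red-triple : i ≢ j → i ≢ k → j ≢ k → Red (i ∷ j ∷ k ∷ [])
Red-triple p q r = Unique⇒Red ((p ∷ q ∷ []) ∷ (r ∷ []) ∷ [] ∷ [])

Red-iki : Adj i k → Red (i ∷ k ∷ i ∷ [])
Red-iki {i = i} {k} a = swap-ascent-conj (toℕ i) (toℕ k) a ∷ Red-pair (Adj⇒≢ a ∘ sym)

-- The word `s` has two letters, and both i and j occur in it, so only their order is open.
Red-≋-pair : i ≢ j → Red s → s ≋ i ∷ j ∷ [] → s ≡ i ∷ j ∷ [] ⊎ s ≡ j ∷ i ∷ []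
Red-≋-pair {s = []}            n r e with () ← Red-length (Red-pair n) r (≋-sym e)
Red-≋-pair {s = a ∷ []}        n r e with s≤s () ← Red-length (Red-pair n) r (≋-sym e)
Red-≋-pair {s = a ∷ b ∷ c ∷ s} n r e with s≤s (s≤s ()) ← Red-length r (Red-pair n) e
Red-≋-pair {i = i} {j} {s = a ∷ b ∷ []} n r e = cases
  (∈-resp-⊑ (Red-pair n) r (≋⇒⊑ (≋-sym e)) (here refl))
  (∈-resp-⊑ (Red-pair n) r (≋⇒⊑ (≋-sym e)) (there (here refl)))
  where
  cases : ∀ {a b} → i ∈ a ∷ b ∷ [] → j ∈ a ∷ b ∷ [] →
    a ∷ b ∷ [] ≡ i ∷ j ∷ [] ⊎ a ∷ b ∷ [] ≡ j ∷ i ∷ []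
  cases (here refl)         (here refl)         = contradiction refl n
  cases (here refl)         (there (here refl)) = inj₁ refl
  cases (there (here refl)) (here refl)         = inj₂ refl
  cases (there (here refl)) (there (here refl)) = contradiction refl n

pair-⊑⇒⊆ : i ≢ j → Red t → i ∷ j ∷ [] ⊑ t → (i ∷ j ∷ [] ⊆ t) ⊎ (¬ Adj i j × j ∷ i ∷ [] ⊆ t)
pair-⊑⇒⊆ n r f with ⊑⇒subword r f
... | s , τ , rs , e with Red-≋-pair n rs e
...   | inj₁ refl = inj₁ τ
...   | inj₂ refl = inj₂ ([ij]≋[ji]⇒¬Adj (≋-sym e) , τ)

adj-pair-⊑⇒⊆ : Adj i j → Red t → i ∷ j ∷ [] ⊑ t → i ∷ j ∷ [] ⊆ t
adj-pair-⊑⇒⊆ a r f with pair-⊑⇒⊆ (Adj⇒≢ a) r f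
... | inj₁ τ       = τ
... | inj₂ (n , _) = contradiction a n

-- Conditions (1)–(3) on the words x and y.
Good : Fin m → Word m → Word m → Set
Good k x y =
  (Unique x × Unique y) ×
  (∀ i → i ∈ x → i ∈ y → Adj i k) ×
  (k ∉ x × k ∉ y)

Good-resp-⊇ : x₁ ⊆ x → y₁ ⊆ y → Good k x y → Good k x₁ y₁
Good-resp-⊇ τ ρ ((ux , uy) , common , k∉x , k∉y) =
  (Unique-resp-⊇ τ ux , Unique-resp-⊇ ρ uy) ,
  (λ i p q → common i (⊆-lookup τ p) (⊆-lookup ρ q)) ,
  k∉x ∘ ⊆-lookup τ , k∉y ∘ ⊆-lookup ρ

-- Were a letter i = k ± 1 of y not to go up, the word i k i would lie below x k y, which contains
-- i and k only once.
Good⇒Red : ∀ (x : Word m) → Good k x y → Red (x ++ k ∷ y)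
Good⇒Red [] ((_ , uy) , _ , _ , k∉y) = ∷⁺-Red (Unique⇒Red uy) k∉y
Good⇒Red {k = k} {y} (i ∷ x) g@((ux@(i≢x ∷ _) , uy) , common , k∉ix , k∉y)
  with r ← Good⇒Red x (Good-resp-⊇ (i ∷ʳ ⊆-refl) ⊆-refl g)
  with pos (x ++ k ∷ y) (toℕ i) <? pos (x ++ k ∷ y) (suc (toℕ i))
... | yes asc = asc ∷ r
... | no ¬asc with ∈-++⁻ x ([i]⊑⇒∈ r (descent-lift {i = i} ¬asc (⊆⇒⊑ r (minimum _))))
...   | inj₁ i∈x         = contradiction i∈x (All¬⇒¬Any i≢x)
...   | inj₂ (here refl) = contradiction (here refl) k∉ix
...   | inj₂ (there i∈y) = contradiction (⊑⇒subword r iki⊑) absurd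
  where
  i~k : Adj i k
  i~k = common i (here refl) i∈y
  iki⊑ : i ∷ k ∷ i ∷ [] ⊑ x ++ k ∷ y
  iki⊑ = descent-lift {i = i} ¬asc (⊆⇒⊑ r (++⁺ˡ x (refl ∷ from∈ i∈y)))
  letter : ∀ {j} → j ∈ i ∷ k ∷ i ∷ [] → j ≡ i ⊎ j ≡ k
  letter (here e)                 = inj₁ e
  letter (there (here e))         = inj₂ e
  letter (there (there (here e))) = inj₁ e
  no-ii : ¬ i ∷ i ∷ [] ⊆ x ++ k ∷ y
  no-ii τ with pair-++⁻ x τ
  ... | inj₁ ρ              = All¬⇒¬Any i≢x (to∈ ρ)
  ... | inj₂ (inj₁ (p , _)) = All¬⇒¬Any i≢x p
  ... | inj₂ (inj₂ (_ ∷ʳ ρ))   = Unique⇒∌pair uy ρ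
  ... | inj₂ (inj₂ (refl ∷ ρ)) = k∉ix (here refl)
  no-kk : ¬ k ∷ k ∷ [] ⊆ x ++ k ∷ y
  no-kk τ with pair-++⁻ x τ
  ... | inj₁ ρ              = k∉ix (there (to∈ ρ))
  ... | inj₂ (inj₁ (p , _)) = k∉ix (there p)
  ... | inj₂ (inj₂ (_ ∷ʳ ρ))   = k∉y (to∈ ρ)
  ... | inj₂ (inj₂ (refl ∷ ρ)) = k∉y (to∈ ρ)
  absurd : ¬ ∃ λ s → s ⊆ x ++ k ∷ y × Red s × s ≋ i ∷ k ∷ i ∷ []
  absurd (s , τ , rs , e)
    -- A word for i k i has at least three letters, each of them i or k, so one of these occurs
    -- twice.
    with pigeonhole (All.tabulate λ p → letter (∈-resp-⊑ rs (Red-iki i~k) (≋⇒⊑ e) p))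
                    (Red-minimal (Red-iki i~k) s (≋-sym e))
  ... | inj₁ ρ = no-ii (⊆-trans ρ τ)
  ... | inj₂ ρ = no-kk (⊆-trans ρ τ)

-- Good words give boolean intervals

Unique-lookup-injective : ∀ {a} {A : Set a} {xs : List A} → Unique xs →
  ∀ c d → lookup xs c ≡ lookup xs d → c ≡ d
Unique-lookup-injective (_ ∷ _)  fzero    fzero    _ = refl
Unique-lookup-injective (n ∷ _)  fzero    (fsuc d) e = contradiction e (All.lookup n (∈-lookup d))
Unique-lookup-injective (n ∷ _)  (fsuc c) fzero    e = contradiction (sym e) (All.lookup n (∈-lookup c))
Unique-lookup-injective (_ ∷ us) (fsuc c) (fsuc d) e = cong fsuc (Unique-lookup-injective us c d e)

-- Both sublists inherit their order from `xs`, where each member has a single position, so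
-- inclusion of members is enough.
Unique-⊆ : ∀ {a} {A : Set a} {xs xs₁ xs₂ : List A} → Unique xs → xs₁ ⊆ xs → xs₂ ⊆ xs →
  (∀ {c} → c ∈ xs₁ → c ∈ xs₂) → xs₁ ⊆ xs₂
Unique-⊆ []       []         []         _ = []
Unique-⊆ (_ ∷ us) (_ ∷ʳ τ)   (_ ∷ʳ ρ)   f = Unique-⊆ us τ ρ f
Unique-⊆ {xs₁ = xs₁} (n ∷ us) (_ ∷ʳ τ) (_∷_ {xs = xs₂} refl ρ) f = _ ∷ʳ Unique-⊆ us τ ρ tail
  where
  tail : ∀ {c} → c ∈ xs₁ → c ∈ xs₂
  tail p with f p
  ... | here refl = contradiction refl (All.lookup n (⊆-lookup τ p))
  ... | there q   = q
Unique-⊆ (n ∷ us) (refl ∷ τ) (_ ∷ʳ ρ)   f =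
  contradiction refl (All.lookup n (⊆-lookup ρ (f (here refl))))
Unique-⊆ (n ∷ us) (_∷_ {xs = xs₁} refl τ) (_∷_ {xs = xs₂} refl ρ) f = refl ∷ Unique-⊆ us τ ρ tail
  where
  tail : ∀ {c} → c ∈ xs₁ → c ∈ xs₂
  tail p with f (there p)
  ... | here refl = contradiction refl (All.lookup n (⊆-lookup τ p))
  ... | there q   = q

-- The k in `s` can only come from the single k of the larger word, which therefore marks where to
-- cut.
split-⊆ : ∀ (x : Word m) {y} → k ∉ x → k ∉ y → s ⊆ x ++ k ∷ y → k ∈ s →
  ∃ λ x₁ → ∃ λ y₁ → s ≡ x₁ ++ k ∷ y₁ × x₁ ⊆ x × y₁ ⊆ y
split-⊆ []      _  k∉y (_ ∷ʳ τ)   p = contradiction (⊆-lookup τ p) k∉y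
split-⊆ []      _  _   (refl ∷ τ) p = [] , _ , refl , [] , τ
split-⊆ (i ∷ x) k∉ k∉y (_ ∷ʳ τ)   p =
  let x₁ , y₁ , e , ρ₁ , ρ₂ = split-⊆ x (k∉ ∘ there) k∉y τ p
  in x₁ , y₁ , e , i ∷ʳ ρ₁ , ρ₂
split-⊆ (i ∷ x) k∉ k∉y (refl ∷ τ) (here refl) = contradiction (here refl) k∉
split-⊆ (i ∷ x) k∉ k∉y (refl ∷ τ) (there p)   =
  let x₁ , y₁ , e , ρ₁ , ρ₂ = split-⊆ x (k∉ ∘ there) k∉y τ p
  in i ∷ x₁ , y₁ , cong (i ∷_) e , refl ∷ ρ₁ , ρ₂

module _ {k : Fin m} {x y : Word m} (good : Good k x y) where

  private
    k∉x : k ∉ x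
    k∉x = proj₁ (proj₂ (proj₂ good))
    k∉y : k ∉ y
    k∉y = proj₂ (proj₂ (proj₂ good))
    common : ∀ i → i ∈ x → i ∈ y → Adj i k
    common = proj₁ (proj₂ good)

  -- The letters of x₁ and y₁ are read off the elements i k and k i below x₁ k y₁.
  good-⊑⇒∈ : x₁ ⊆ x → y₁ ⊆ y → x₂ ⊆ x → y₂ ⊆ y → x₁ ++ k ∷ y₁ ⊑ x₂ ++ k ∷ y₂ →
    (∀ {i} → i ∈ x₁ → i ∈ x₂) × (∀ {i} → i ∈ y₁ → i ∈ y₂)
  good-⊑⇒∈ {x₁} {y₁} {x₂} {y₂} τ₁ ρ₁ τ₂ ρ₂ f = left , right
    where
    r₁ = Good⇒Red x₁ (Good-resp-⊇ τ₁ ρ₁ good)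
    r₂ = Good⇒Red x₂ (Good-resp-⊇ τ₂ ρ₂ good)
    before : ∀ {i} → i ∷ k ∷ [] ⊆ x₂ ++ k ∷ y₂ → i ∈ x₂
    before σ with pair-++⁻ x₂ σ
    ... | inj₁ σ′                = contradiction (⊆-lookup τ₂ (⊆-lookup σ′ (there (here refl)))) k∉x
    ... | inj₂ (inj₁ (p , _))    = p
    ... | inj₂ (inj₂ (_ ∷ʳ σ′))  = contradiction (⊆-lookup ρ₂ (⊆-lookup σ′ (there (here refl)))) k∉y
    ... | inj₂ (inj₂ (_ ∷ σ′))   = contradiction (⊆-lookup ρ₂ (⊆-lookup σ′ (here refl))) k∉y
    after : ∀ {i} → k ∷ i ∷ [] ⊆ x₂ ++ k ∷ y₂ → i ∈ y₂
    after σ with pair-++⁻ x₂ σ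
    ... | inj₁ σ′                = contradiction (⊆-lookup τ₂ (to∈ σ′)) k∉x
    ... | inj₂ (inj₁ (p , _))    = contradiction (⊆-lookup τ₂ p) k∉x
    ... | inj₂ (inj₂ (_ ∷ʳ σ′))  = contradiction (⊆-lookup ρ₂ (to∈ σ′)) k∉y
    ... | inj₂ (inj₂ (_ ∷ σ′))   = to∈ σ′
    left : ∀ {i} → i ∈ x₁ → i ∈ x₂
    left {i} p with pair-⊑⇒⊆ (λ { refl → k∉x (⊆-lookup τ₁ p) }) r₂
                      (⊑-trans (⊆⇒⊑ r₁ (++⁺ (from∈ p) (refl ∷ minimum y₁))) f)
    ... | inj₁ σ       = before σ
    -- The order k i would put i into y as well as into x, so i would be adjacent to k; but only
    -- commuting letters can appear reversed.
    ... | inj₂ (n , σ) = contradiction (common i (⊆-lookup τ₁ p) (⊆-lookup ρ₂ (after σ))) n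
    right : ∀ {i} → i ∈ y₁ → i ∈ y₂
    right {i} p with pair-⊑⇒⊆ (λ { refl → k∉y (⊆-lookup ρ₁ p) }) r₂
                       (⊑-trans (⊆⇒⊑ r₁ (++⁺ˡ x₁ (refl ∷ from∈ p))) f)
    ... | inj₁ σ       = after σ
    ... | inj₂ (n , σ) = contradiction (~-sym (common i (⊆-lookup τ₂ (before σ)) (⊆-lookup ρ₁ p))) n

[-]-spells : ∀ (k : Fin m) → (k ∷ []) spells σ k
[-]-spells k = spelling Red-[-] λ _ → refl

module _ {k : Fin m} {w : 𝔖 m} {x y : Word m} (good : Good k x y) (ω-spells : x ++ k ∷ y spells w) where

  private
    k∉x : k ∉ x
    k∉x = proj₁ (proj₂ (proj₂ good))
    k∉y : k ∉ y
    k∉y = proj₂ (proj₂ (proj₂ good))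
    module I = RawRelation [ σ k , w ]

    record Factored (v : 𝔖 m) : Set where
      field
        {left right} : Word m
        left⊆   : left ⊆ x
        right⊆  : right ⊆ y
        factors : left ++ k ∷ right spells v

    open Factored

    -- The subword property spells the element inside x k y, and k survives there because σ k lies
    -- below the element.
    factor : ∀ (e : I.Carrier) → Factored (proj₁ e)
    factor (v , σk≤v , v≤w) =
      let s , sp = spelling-below v w v≤w
          s′ , τ , r′ , e = ⊑⇒subword (red ω-spells) (≤ᴮ⇒⊑ sp ω-spells v≤w)
          k∈s′ = [i]⊑⇒∈ r′ (⊑-trans (≤ᴮ⇒⊑ ([-]-spells k) sp σk≤v) (≋⇒⊑ (≋-sym e)))
          x₁ , y₁ , eq , ρ₁ , ρ₂ = split-⊆ x k∉x k∉y τ k∈s′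
      in record { left⊆ = ρ₁ ; right⊆ = ρ₂ ; factors = subst (_spells v) eq (spells-cong r′ e sp) }

    element : x₁ ⊆ x → y₁ ⊆ y → I.Carrier
    element {x₁} {y₁} τ ρ =
      let r = Good⇒Red x₁ (Good-resp-⊇ τ ρ good)
      in ⟦ x₁ ++ k ∷ y₁ ⟧
       , ⊑⇒≤ᴮ ([-]-spells k) (⟦⟧-spells r) (∈⇒[i]⊑ r (∈-++⁺ʳ x₁ (here refl)))
       , ⊑⇒≤ᴮ (⟦⟧-spells r) ω-spells (⊆⇒⊑ (red ω-spells) (++⁺ τ (refl ∷ ρ)))

    -- A disjoint sum, because a neighbour of k occurring in both x and y has to count twice.
    Letter : Set
    Letter = Fin m ⊎ Fin m

    letters : List Letter
    letters = map inj₁ x ++ map inj₂ y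

    letters-unique : Unique letters
    letters-unique = Unique.++⁺ (Unique.map⁺ inj₁-injective (proj₁ (proj₁ good)))
                                (Unique.map⁺ inj₂-injective (proj₂ (proj₁ good)))
                                λ (p , q) → disjoint (∈-map⁻ inj₁ p) (∈-map⁻ inj₂ q)
      where
      disjoint : ∀ {c} → (∃ λ i → i ∈ x × c ≡ inj₁ i) → ¬ (∃ λ i → i ∈ y × c ≡ inj₂ i)
      disjoint (_ , _ , refl) (_ , _ , ())

    In : Word m → Word m → Letter → Set
    In x₁ y₁ = [ _∈ x₁ , _∈ y₁ ]′

    In? : ∀ x₁ y₁ c → Dec (In x₁ y₁ c)
    In? x₁ y₁ (inj₁ i) = any? (i Fin.≟_) x₁
    In? x₁ y₁ (inj₂ i) = any? (i Fin.≟_) y₁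

    letters⁺ : ∀ c → In x y c → ∃ λ a → lookup letters a ≡ c
    letters⁺ c p = index (membership c p) , sym (lookup-index (membership c p))
      where
      membership : ∀ c → In x y c → c ∈ letters
      membership (inj₁ i) p = ∈-++⁺ˡ (∈-map⁺ inj₁ p)
      membership (inj₂ i) p = ∈-++⁺ʳ (map inj₁ x) (∈-map⁺ inj₂ p)

    letters⁻ : ∀ a → In x y (lookup letters a)
    letters⁻ a with ∈-++⁻ (map inj₁ x) (∈-lookup {xs = letters} a)
    ... | inj₁ p = let i , i∈x , e = ∈-map⁻ inj₁ p in subst (In x y) (sym e) i∈x
    ... | inj₂ p = let i , i∈y , e = ∈-map⁻ inj₂ p in subst (In x y) (sym e) i∈y

    subset : Word m → Word m → Subset (length letters)
    subset x₁ y₁ = tabulate λ a → does (In? x₁ y₁ (lookup letters a))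

    ∈-subset⁺ : ∀ a → In x₁ y₁ (lookup letters a) → a ∈ₛ subset x₁ y₁
    ∈-subset⁺ {x₁} {y₁} a p = lookup⇒[]= a (subset x₁ y₁)
      (trans (lookup∘tabulate _ a) (dec-true (In? x₁ y₁ (lookup letters a)) p))

    ∈-subset⁻ : ∀ a → a ∈ₛ subset x₁ y₁ → In x₁ y₁ (lookup letters a)
    ∈-subset⁻ {x₁} {y₁} a p
      with In? x₁ y₁ (lookup letters a)
         | trans (sym (lookup∘tabulate (λ a → does (In? x₁ y₁ (lookup letters a))) a)) ([]=⇒lookup p)
    ... | yes q | _  = q
    ... | no _  | ()

    subset-mono : x₁ ⊆ x → y₁ ⊆ y → x₂ ⊆ x → y₂ ⊆ y → x₁ ++ k ∷ y₁ ⊑ x₂ ++ k ∷ y₂ →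
      subset x₁ y₁ ⊆ₛ subset x₂ y₂
    subset-mono {x₁} {y₁} {x₂} {y₂} τ₁ ρ₁ τ₂ ρ₂ g {a} p =
      ∈-subset⁺ a (In-map (lookup letters a) (∈-subset⁻ a p))
      where
      In-map : ∀ c → In x₁ y₁ c → In x₂ y₂ c
      In-map (inj₁ i) = proj₁ (good-⊑⇒∈ good τ₁ ρ₁ τ₂ ρ₂ g)
      In-map (inj₂ i) = proj₂ (good-⊑⇒∈ good τ₁ ρ₁ τ₂ ρ₂ g)

    f : I.Carrier → Subset (length letters)
    f e = subset (left (factor e)) (right (factor e))

    f-mono : ∀ d e → d I.∼ e → f d ⊆ₛ f e
    f-mono d e d≤e = subset-mono
      (left⊆ (factor d)) (right⊆ (factor d)) (left⊆ (factor e)) (right⊆ (factor e))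
      (≤ᴮ⇒⊑ (factors (factor d)) (factors (factor e)) d≤e)

    -- An inclusion of letter sets makes the left and right factors of d subwords of those of e, and
    -- subwords of a reduced word lie below it.
    f-cancel : ∀ d e → f d ⊆ₛ f e → d I.∼ e
    f-cancel d e g = ⊑⇒≤ᴮ D.factors E.factors (⊆⇒⊑ (red E.factors)
      (++⁺ (Unique-⊆ (proj₁ (proj₁ good)) D.left⊆ E.left⊆
             λ {i} p → In-map (inj₁ i) (⊆-lookup D.left⊆ p) p)
           (refl ∷ Unique-⊆ (proj₂ (proj₁ good)) D.right⊆ E.right⊆
             λ {i} p → In-map (inj₂ i) (⊆-lookup D.right⊆ p) p)))
      where
      module D = Factored (factor d)
      module E = Factored (factor e)
      In-map : ∀ c → In x y c → In D.left D.right c → In E.left E.right c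
      In-map c p q =
        let a , eq = letters⁺ c p
        in subst (In _ _) eq (∈-subset⁻ a (g {a} (∈-subset⁺ a (subst (In _ _) (sym eq) q))))

    module _ (S : Subset (length letters)) where

      Selected : Letter → Set
      Selected c = ∃ λ a → lookup letters a ≡ c × a ∈ₛ S

      selected? : ∀ c → Dec (Selected c)
      selected? c = Fin.any? λ a → ≡-dec Fin._≟_ Fin._≟_ (lookup letters a) c ×-dec (a ∈ₛ? S)

      x-part y-part : Word m
      x-part = filter (selected? ∘ inj₁) x
      y-part = filter (selected? ∘ inj₂) y

      In-parts⁺ : ∀ c → In x y c → Selected c → In x-part y-part c
      In-parts⁺ (inj₁ i) = ∈-filter⁺ (selected? ∘ inj₁)
      In-parts⁺ (inj₂ i) = ∈-filter⁺ (selected? ∘ inj₂)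

      In-parts⁻ : ∀ c → In x-part y-part c → Selected c
      In-parts⁻ (inj₁ i) = proj₂ ∘ ∈-filter⁻ (selected? ∘ inj₁) {xs = x}
      In-parts⁻ (inj₂ i) = proj₂ ∘ ∈-filter⁻ (selected? ∘ inj₂) {xs = y}

      subset-parts : subset x-part y-part ≡ S
      subset-parts = ⊆ₛ-antisym
        (λ {a} p → let b , e , q = In-parts⁻ (lookup letters a) (∈-subset⁻ a p)
                   in subst (_∈ₛ S) (Unique-lookup-injective letters-unique b a e) q)
        (λ {a} p → ∈-subset⁺ a (In-parts⁺ (lookup letters a) (letters⁻ a) (a , refl , p)))

      preimage : I.Carrier
      preimage = element (filter-⊆ (selected? ∘ inj₁) x) (filter-⊆ (selected? ∘ inj₂) y)

      -- The words that `factor` chooses need not be `x-part` and `y-part`, but they give the same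
      -- permutation, so the two letter sets include each other.
      f-preimage : ∀ {e} → e I.≈ preimage → f e ≡ S
      f-preimage {e} e≈p = trans (⊆ₛ-antisym
          (subset-mono (left⊆ (factor e)) (right⊆ (factor e)) x-part⊆ y-part⊆ (≋⇒⊑ same))
          (subset-mono x-part⊆ y-part⊆ (left⊆ (factor e)) (right⊆ (factor e)) (≋⇒⊑ (≋-sym same))))
        subset-parts
        where
        x-part⊆ = filter-⊆ (selected? ∘ inj₁) x
        y-part⊆ = filter-⊆ (selected? ∘ inj₂) y
        same : left (factor e) ++ k ∷ right (factor e) ≋ x-part ++ k ∷ y-part
        same = spells-≈⇒≋ (factors (factor e))
          (⟦⟧-spells (Good⇒Red x-part (Good-resp-⊇ x-part⊆ y-part⊆ good))) e≈p

    ≈⇒∼ : ∀ d e → d I.≈ e → d I.∼ e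
    ≈⇒∼ d e d≈e = ⊑⇒≤ᴮ (factors (factor d)) (factors (factor e))
      (≋⇒⊑ (spells-≈⇒≋ (factors (factor d)) (factors (factor e)) d≈e))

    ∼-antisym : ∀ d e → d I.∼ e → e I.∼ d → d I.≈ e
    ∼-antisym d e p q = spells-≋⇒≈ (factors (factor d)) (factors (factor e))
      (⊑-antisym (≤ᴮ⇒⊑ (factors (factor d)) (factors (factor e)) p)
                 (≤ᴮ⇒⊑ (factors (factor e)) (factors (factor d)) q))

  Good⇒Boolean : Boolean [ σ k , w ]
  Good⇒Boolean = length letters , f , record
    { isOrderMonomorphism = record
      { isOrderHomomorphism = record
        { cong = λ {d} {e} d≈e → ⊆ₛ-antisym
            (f-mono d e (≈⇒∼ d e d≈e)) (f-mono e d (≈⇒∼ e d (sym ∘ d≈e)))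
        ; mono = λ {d} {e} → f-mono d e }
      ; injective = λ {d} {e} fd≡fe → ∼-antisym d e
          (f-cancel d e λ {a} → subst (a ∈ₛ_) fd≡fe)
          (f-cancel e d λ {a} → subst (a ∈ₛ_) (sym fd≡fe))
      ; cancel = λ {d} {e} g → f-cancel d e λ {a} → g {a}
      }
    ; surjective = λ S → preimage S , λ {e} → f-preimage S {e}
    }

-- Unobstructed words are good

-- The configurations that modularity of [ σ k , ⟦ t ⟧ ] rules out.
record Unobstructed {m} (k : Fin m) (t : Word m) : Set where
  field
    before : ∀ {i j} → Adj i j → i ≢ k → j ≢ k → i ∷ j ∷ k ∷ [] ⊑ t → ¬ j ∷ i ∷ k ∷ [] ⊑ t
    after  : ∀ {i j} → Adj i j → i ≢ k → j ≢ k → k ∷ i ∷ j ∷ [] ⊑ t → ¬ k ∷ j ∷ i ∷ [] ⊑ t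
    around : ∀ {i j} → Adj i k → Adj j k → i ≢ j → ¬ k ∷ i ∷ j ∷ k ∷ [] ⊑ t

open Unobstructed

Unobstructed-⊑ : s ⊑ t → Unobstructed k t → Unobstructed k s
Unobstructed-⊑ f u = record
  { before = λ a p q g h → before u a p q (⊑-trans g f) (⊑-trans h f)
  ; after  = λ a p q g h → after u a p q (⊑-trans g f) (⊑-trans h f)
  ; around = λ a b p g → around u a b p (⊑-trans g f)
  }

Factorisation : Fin m → Word m → Set
Factorisation k t = ∃ λ x → ∃ λ y → Good k x y × x ++ k ∷ y ≋ t

∈∧∉⇒≢ : ∀ {a} {A : Set a} {c d : A} {xs} → c ∈ xs → d ∉ xs → c ≢ d
∈∧∉⇒≢ p q refl = q p

-- Between two occurrences of i a reduced word has some neighbour j of i, which yields the subword i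
-- j i.
Red∧no-iji⇒Unique : Red t → (∀ {i j} → Adj i j → ¬ i ∷ j ∷ i ∷ [] ⊆ t) → Unique t
Red∧no-iji⇒Unique []                     _ = []
Red∧no-iji⇒Unique {t = i ∷ t} r@(_ ∷ r′) h =
  ¬Any⇒All¬ t i∉t ∷ Red∧no-iji⇒Unique r′ (λ a τ → h a (i ∷ʳ τ))
  where
  i∉t : i ∉ t
  i∉t p with ∈-∃++ p
  ... | a , b , refl =
    let j , j∈a , i~j = Red-between a r
    in h i~j (refl ∷ ++⁺ (from∈ j∈a) (refl ∷ minimum b))

module _ {k : Fin m} {i : Fin m} where

  -- If i recurs in `x`, a neighbour j stands between the two occurrences, and both i j k and j i k
  -- are subwords.
  i∉left : i ≢ k → Good k x y → Red (i ∷ x ++ k ∷ y) → Unobstructed k (i ∷ x ++ k ∷ y) → i ∉ x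
  i∉left {y = y} i≢k (_ , _ , k∉x , _) r u p with ∈-∃++ p
  ... | a , b , refl =
    let j , j∈a , i~j = Red-between a (subst (Red ∘ (i ∷_)) (++-assoc a (i ∷ b) (k ∷ y)) r)
    in before u i~j i≢k (∈∧∉⇒≢ (∈-++⁺ˡ j∈a) k∉x)
         (⊆⇒⊑ r (refl ∷ ++⁺ (from∈ (∈-++⁺ˡ j∈a)) (refl ∷ minimum y)))
         (⊆⇒⊑ r (i ∷ʳ ++⁺ (++⁺ (from∈ j∈a) (refl ∷ minimum b)) (refl ∷ minimum y)))

  -- Suppose i commutes with k and take a neighbour j of i between its two occurrences. If j is in
  -- `x`, then i j k and j k i = j i k are subwords; if j is in `y`, then k j i and i k j = k i j
  -- are. The case j = k is excluded.
  i∈right⇒Adj : i ≢ k → Good k x y → Red (i ∷ x ++ k ∷ y) → Unobstructed k (i ∷ x ++ k ∷ y) →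
    i ∈ y → Adj i k
  i∈right⇒Adj {x = x} i≢k (_ , _ , k∉x , k∉y) r u p with adj? i k | ∈-∃++ p
  ... | yes a | _ = a
  ... | no ¬i~k | c , d , refl
    with Red-between (x ++ k ∷ c) (subst (Red ∘ (i ∷_)) (sym (++-assoc x (k ∷ c) (i ∷ d))) r)
  ... | j , j∈ , i~j with ∈-++⁻ x j∈
  ... | inj₁ j∈x = contradiction
    (⊑-trans (≋⇒⊑ (≋-∷ j (∷∷-comm [] ¬i~k)))
             (⊆⇒⊑ r (i ∷ʳ ++⁺ (from∈ j∈x) (refl ∷ from∈ p))))
    (before u i~j i≢k (∈∧∉⇒≢ j∈x k∉x) (⊆⇒⊑ r (refl ∷ ++⁺ (from∈ j∈x) (refl ∷ minimum _))))
  ... | inj₂ (here refl) = i~j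
  ... | inj₂ (there j∈c) = contradiction
    (⊆⇒⊑ r (i ∷ʳ ++⁺ˡ x (refl ∷ ++⁺ (from∈ j∈c) (refl ∷ minimum d))))
    (after u i~j i≢k (∈∧∉⇒≢ (∈-++⁺ˡ j∈c) k∉y)
      (⊑-trans (≋⇒⊑ (∷∷-comm (j ∷ []) (¬i~k ∘ ~-sym)))
               (⊆⇒⊑ r (refl ∷ ++⁺ˡ x (refl ∷ from∈ (∈-++⁺ˡ j∈c))))))

-- With a and b commuting with k, k a j b k y = a k j k b y = a j k j b y.
factorise-kxky : ∀ {x} → Good k x y → Red (k ∷ x ++ k ∷ y) → Unobstructed k (k ∷ x ++ k ∷ y) →
  Factorisation k (k ∷ x ++ k ∷ y)
factorise-kxky {k = k} {y} {x} ((ux , uy) , common , k∉x , k∉y) r u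
  with j , j∈x , k~j ← Red-between x r
  with ∈-∃++ j∈x
... | a , b , refl with any? (adj? k) a | any? (adj? k) b
-- A neighbour of k in a, or below in b, is different from j since `x` has no repetitions. It is
-- thus the other neighbour, and k occurs on both sides of the pair.
...   | yes p | _ = contradiction
        (⊆⇒⊑ r (refl ∷ ++⁺ (++⁺ (from∈ i∈a) (refl ∷ minimum b)) (refl ∷ minimum y)))
        (around u (~-sym k~i) (~-sym k~j)
          λ e → Unique⇒∌pair ux (++⁺ (from∈ (subst (_∈ a) e i∈a)) (refl ∷ minimum b)))
        where
        i∈a = proj₁ (proj₂ (find p))
        k~i = proj₂ (proj₂ (find p))
...   | no _  | yes p = contradiction
        (⊆⇒⊑ r (refl ∷ ++⁺ (++⁺ˡ a (refl ∷ from∈ i∈b)) (refl ∷ minimum y)))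
        (around u (~-sym k~j) (~-sym k~i)
          λ e → Unique⇒∌pair ux (++⁺ˡ a (refl ∷ from∈ (subst (_∈ b) (sym e) i∈b))))
        where
        i∈b = proj₁ (proj₂ (find p))
        k~i = proj₂ (proj₂ (find p))
...   | no ¬a | no ¬b = a ++ j ∷ [] , j ∷ b ++ y , good ,
  ≋-trans (≋-reflexive (++-assoc a (j ∷ []) _)) (≋-sym rewritten)
  where
  rewritten : k ∷ (a ++ j ∷ b) ++ k ∷ y ≋ a ++ j ∷ k ∷ j ∷ b ++ y
  rewritten = ≋-trans (≋-∷ k (≋-reflexive (++-assoc a (j ∷ b) (k ∷ y))))
    (≋-trans (comm-past (j ∷ b ++ k ∷ y) (¬Any⇒All¬ a ¬a))
    (≋-++ˡ a (≋-trans (≋-∷ k (≋-∷ j (≋-sym (comm-past y (¬Any⇒All¬ b ¬b)))))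
                      (∷∷∷-braid (b ++ y) k~j))))
  same-length : length (a ++ j ∷ k ∷ j ∷ b ++ y) ≡ length (k ∷ (a ++ j ∷ b) ++ k ∷ y)
  same-length = trans (trans (length-++ a) (cong (λ n → length a + (3 + n)) (length-++ b)))
    (trans (arith (length a) (length b) (length y))
      (cong suc (sym (trans (length-++ (a ++ j ∷ b)) (cong (_+ suc (length y)) (length-++ a))))))
    where
    arith : ∀ p q n → p + (3 + (q + n)) ≡ suc ((p + suc q) + suc n)
    arith = solve-∀
  r′ : Red (a ++ j ∷ k ∷ j ∷ b ++ y)
  r′ = Red-≋ r (≋-sym rewritten) (≤-reflexive same-length)
  u′ : Unobstructed k (a ++ j ∷ k ∷ j ∷ b ++ y)
  u′ = Unobstructed-⊑ (≋⇒⊑ (≋-sym rewritten)) u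
  -- A second j in y would come after some neighbour i of j in b or in y, and then both k j i and k
  -- i j would be subwords.
  j∉y : j ∉ y
  j∉y p with ∈-∃++ p
  ... | c , d , refl with ++-assoc b c (j ∷ d) | Red-++⁻ʳ a r′
  ... | e | _ ∷ _ ∷ r″ with Red-between (b ++ c) (subst (Red ∘ (j ∷_)) (sym e) r″)
  ... | i , i∈bc , j~i = after u′ j~i (Adj⇒≢ k~j ∘ sym)
    (∈∧∉⇒≢ i∈bc ([ k∉x ∘ ∈-++⁺ʳ a ∘ there , k∉y ∘ ∈-++⁺ˡ ]′ ∘ ∈-++⁻ b))
    (⊆⇒⊑ r′ (++⁺ˡ a (j ∷ʳ refl ∷ refl ∷ from∈ (subst (i ∈_) e (∈-++⁺ˡ i∈bc)))))
    (⊆⇒⊑ r′ (++⁺ˡ a (j ∷ʳ refl ∷ j ∷ʳ subst (_ ⊆_) e (++⁺ (from∈ i∈bc) (refl ∷ minimum d)))))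
  k≁b : ∀ {i} → i ∈ b → ¬ Adj i k
  k≁b p a = All.lookup (¬Any⇒All¬ b ¬b) p (~-sym a)
  good : Good k (a ++ j ∷ []) (j ∷ b ++ y)
  good =
    ( Unique-resp-⊇ (++⁺ (⊆-refl {x = a}) (refl ∷ minimum b)) ux
    , Unique.++⁺ (Unique-resp-⊇ (++⁺ˡ a ⊆-refl) ux) uy
        -- A letter common to b and y would be common to x and y, hence adjacent to k, but no letter
        -- of b is.
        (λ { (here refl , q) → j∉y q ; (there p , q) → k≁b p (common _ (∈-++⁺ʳ a (there p)) q) })) ,
    (λ i p q → shared i (∈-++⁻ a p) (∈-++⁻ (j ∷ b) q)) ,
    (λ p → [ k∉x ∘ ∈-++⁺ˡ , (λ { (here refl) → ~-irrefl k~j }) ]′ (∈-++⁻ a p)) ,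
    (λ p → [ k∉x ∘ ∈-++⁺ʳ a , k∉y ]′ (∈-++⁻ (j ∷ b) p))
    where
    shared : ∀ i → i ∈ a ⊎ i ∈ j ∷ [] → i ∈ j ∷ b ⊎ i ∈ y → Adj i k
    shared i (inj₂ (here refl)) _        = ~-sym k~j
    shared i (inj₁ p)           (inj₁ q) = contradiction (++⁺ (from∈ p) (from∈ q)) (Unique⇒∌pair ux)
    shared i (inj₁ p)           (inj₂ q) = common i (∈-++⁺ˡ p) q

factorise : Red t → k ∈ t → Unobstructed k t → Factorisation k t
factorise {t = i ∷ t} {k} (asc ∷ r) p u with any? (k Fin.≟_) t
factorise {t = i ∷ t} {k} (asc ∷ r) (there p)   u | no k∉t = contradiction p k∉t
-- This is the rightmost k. The tail serves as y: a subword a b a of it, with a and b adjacent,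
-- would give both k a b and k b a.
factorise {t = i ∷ t} {i} (asc ∷ r) (here refl) u | no i∉t =
  [] , t , (([] , ut) , (λ _ ()) , (λ ()) , i∉t) , ≋-refl
  where
  ut : Unique t
  ut = Red∧no-iji⇒Unique r λ a τ →
    after u a (∈∧∉⇒≢ (to∈ τ) i∉t) (∈∧∉⇒≢ (⊆-lookup τ (there (here refl))) i∉t)
      (⊆⇒⊑ (asc ∷ r) (refl ∷ ⊆-trans (refl ∷ refl ∷ minimum _) τ))
      (⊆⇒⊑ (asc ∷ r) (refl ∷ ⊆-trans (_ ∷ʳ ⊆-refl) τ))
factorise {t = i ∷ t} {k} (asc ∷ r) _ u | yes k∈t
  with factorise r k∈t (Unobstructed-⊑ (⊑-∷ asc) u)
... | x , y , good@((ux , uy) , common , k∉x , k∉y) , e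
  with r′ ← Red-∷-cong (≋-sym e) (Good⇒Red x good) (asc ∷ r)
  with u′ ← Unobstructed-⊑ (≋⇒⊑ (≋-∷ i e)) u
  with i Fin.≟ k
... | yes refl =
  let x′ , y′ , good′ , e′ = factorise-kxky good r′ u′
  in x′ , y′ , good′ , ≋-trans e′ (≋-∷ i e)
... | no i≢k = i ∷ x , y ,
  ( (¬Any⇒All¬ x (i∉left i≢k good r′ u′) ∷ ux , uy)
  , (λ { _ (here refl) q → i∈right⇒Adj i≢k good r′ u′ q ; j (there p) q → common j p q })
  , (λ { (here e) → i≢k (sym e) ; (there p) → k∉x p })
  , k∉y ) , ≋-∷ i e

-- Lattices

module _ {a ℓ₁ ℓ₂} (P : RawRelation a ℓ₁ ℓ₂) where
  open RawRelation P using (Carrier) renaming (_≈_ to _≈ₚ_; _∼_ to _≤ₚ_)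

  -- By the modular law z ≤ (x ∨ y) ∧ z = x ∨ (y ∧ z) ≤ x.
  modular-collapse : ((_∨_ , _∧_ , _) : ModularLattice P) → ∀ {x y z} →
    x ≤ₚ z → z ≤ₚ (x ∨ y) → (y ∧ z) ≤ₚ x → z ≤ₚ x
  modular-collapse (_∨_ , _∧_ , isLattice , modular) {x} {y} {z} x≤z z≤x∨y y∧z≤x =
    L.trans (L.∧-greatest z≤x∨y L.refl)
      (L.trans (L.reflexive (L.Eq.sym (modular x y z x≤z))) (L.∨-least L.refl y∧z≤x))
    where module L = IsLattice isLattice

  -- One inequality holds in every lattice; for the other, (x ∨ y) ∧ z = (z ∧ x) ∨ (z ∧ y) ≤ x ∨ (y
  -- ∧ z).
  Distributive⇒Modular : DistributiveLattice P → ModularLattice P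
  Distributive⇒Modular (_∨_ , _∧_ , isDL) = _∨_ , _∧_ , D.isLattice , λ x y z x≤z → D.antisym
    (D.∨-least (D.∧-greatest (D.x≤x∨y x y) x≤z)
      (D.∧-greatest (D.trans (D.x∧y≤x y z) (D.y≤x∨y x y)) (D.x∧y≤y y z)))
    (D.trans (D.∧-greatest (D.x∧y≤y _ z) (D.x∧y≤x _ z))
      (D.trans (D.reflexive (D.∧-distribˡ-∨ z x y))
        (D.∨-least (D.trans (D.x∧y≤y z x) (D.x≤x∨y x _))
          (D.trans (D.∧-greatest (D.x∧y≤y z y) (D.x∧y≤x z y)) (D.y≤x∨y x _)))))
    where module D = IsDistributiveLattice isDL

  -- The relation comes without order axioms, so these too, along with union and intersection, are
  -- pulled back through the isomorphism.
  Boolean⇒Distributive : Boolean P → DistributiveLattice P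
  Boolean⇒Distributive (r , f , iso) = _∨_ , _∧_ , record
    { isLattice = record
      { isPartialOrder = record
        { isPreorder = record
          { isEquivalence = record
            { refl  = F.injective refl
            ; sym   = λ p → F.injective (sym (F.cong p))
            ; trans = λ p q → F.injective (trans (F.cong p) (F.cong q)) }
          ; reflexive = λ {d} {e} p → F.cancel λ {c} → subst (c ∈ₛ_) (F.cong p)
          ; trans     = λ {d} {e} {h} p q → F.cancel λ {c} → F.mono q {c} ∘ F.mono p {c} }
        ; antisym = λ p q → F.injective (⊆ₛ-antisym (F.mono p) (F.mono q)) }
      ; supremum = λ d e →
          F.cancel (λ {c} → subst (c ∈ₛ_) (sym (f∘g _)) ∘ p⊆p∪q (f e)) ,
          F.cancel (λ {c} → subst (c ∈ₛ_) (sym (f∘g _)) ∘ q⊆p∪q (f d) (f e)) ,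
          λ h p q → F.cancel λ {c} →
            [ F.mono p {c} , F.mono q {c} ]′ ∘ x∈p∪q⁻ (f d) (f e) ∘ subst (c ∈ₛ_) (f∘g _)
      ; infimum = λ d e →
          F.cancel (λ {c} → p∩q⊆p (f d) (f e) ∘ subst (c ∈ₛ_) (f∘g _)) ,
          F.cancel (λ {c} → p∩q⊆q (f d) (f e) ∘ subst (c ∈ₛ_) (f∘g _)) ,
          λ h p q → F.cancel λ {c} c∈ →
            subst (c ∈ₛ_) (sym (f∘g _)) (x∈p∩q⁺ (F.mono p c∈ , F.mono q c∈)) }
    ; ∧-distribˡ-∨ = λ d e h → F.injective
        (trans (f∘g _) (trans (cong (f d ∩_) (f∘g _))
          (trans (∩-distribˡ-∪ (f d) (f e) (f h))
            (sym (trans (f∘g _) (cong₂ _∪_ (f∘g _) (f∘g _)))))))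
    }
    where
    module F = IsOrderIsomorphism iso
    g : Subset r → Carrier
    g S = proj₁ (F.surjective S)
    f∘g : ∀ S → f (g S) ≡ S
    f∘g S = proj₂ (F.surjective S) (F.injective refl)
    _∨_ _∧_ : Carrier → Carrier → Carrier
    d ∨ e = g (f d ∪ f e)
    d ∧ e = g (f d ∩ f e)

-- Modular intervals are unobstructed

module _ {k : Fin m} {w : 𝔖 m} {t : Word m}
         (t-spells : t spells w) (modular : ModularLattice [ σ k , w ]) where

  private
    module I = RawRelation [ σ k , w ]
    _∨_ = proj₁ modular
    _∧_ = proj₁ (proj₂ modular)
    module L = IsLattice (proj₁ (proj₂ (proj₂ modular)))

    element : Red s → k ∈ s → s ⊑ t → I.Carrier
    element {s} r p f = ⟦ s ⟧ , ⊑⇒≤ᴮ ([-]-spells k) (⟦⟧-spells r) (∈⇒[i]⊑ r p)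
                              , ⊑⇒≤ᴮ (⟦⟧-spells r) t-spells f

    word : I.Carrier → Word m
    word (v , _ , v≤w) = proj₁ (spelling-below v w v≤w)

    word-spells : ∀ e → word e spells proj₁ e
    word-spells (v , _ , v≤w) = proj₂ (spelling-below v w v≤w)

    k∈word : ∀ e → k ∈ word e
    k∈word e@(_ , σk≤v , _) = [i]⊑⇒∈ (red (word-spells e)) (≤ᴮ⇒⊑ ([-]-spells k) (word-spells e) σk≤v)

    -- The join of a₁ and a₂ lies below e₁ and e₂, so by its length it is a₁ and a₂, or e₁ and e₂.
    no-square : ∀ {a₁ a₂ e₁ e₂ : Word m} →
      Red a₁ → Red a₂ → Red e₁ → Red e₂ → k ∈ a₁ → k ∈ a₂ →
      length a₁ ≡ 2 → length a₂ ≡ 2 → length e₁ ≡ 3 → length e₂ ≡ 3 →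
      a₁ ⊑ e₁ → a₁ ⊑ e₂ → a₂ ⊑ e₁ → a₂ ⊑ e₂ → e₁ ⊑ t → e₂ ⊑ t →
      a₁ ≋ a₂ ⊎ e₁ ≋ e₂
    no-square {a₁} {a₂} {e₁} {e₂} ra₁ ra₂ re₁ re₂ p₁ p₂ la₁ la₂ le₁ le₂ f₁₁ f₁₂ f₂₁ f₂₂ g₁ g₂ =
      decide (length z ≤? 2)
      where
      A₁ = element ra₁ p₁ (⊑-trans f₁₁ g₁)
      A₂ = element ra₂ p₂ (⊑-trans f₂₁ g₁)
      E₁ = element re₁ (∈-resp-⊑ ra₁ re₁ f₁₁ p₁) g₁
      E₂ = element re₂ (∈-resp-⊑ ra₁ re₂ f₁₂ p₁) g₂
      z  = word (A₁ ∨ A₂)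
      z-spells = word-spells (A₁ ∨ A₂)
      a₁⊑z : a₁ ⊑ z
      a₁⊑z = ≤ᴮ⇒⊑ (⟦⟧-spells ra₁) z-spells (L.x≤x∨y A₁ A₂)
      a₂⊑z : a₂ ⊑ z
      a₂⊑z = ≤ᴮ⇒⊑ (⟦⟧-spells ra₂) z-spells (L.y≤x∨y A₁ A₂)
      z⊑e₁ : z ⊑ e₁
      z⊑e₁ = ≤ᴮ⇒⊑ z-spells (⟦⟧-spells re₁) (L.∨-least {A₁} {A₂} {E₁}
        (⊑⇒≤ᴮ (⟦⟧-spells ra₁) (⟦⟧-spells re₁) f₁₁) (⊑⇒≤ᴮ (⟦⟧-spells ra₂) (⟦⟧-spells re₁) f₂₁))
      z⊑e₂ : z ⊑ e₂
      z⊑e₂ = ≤ᴮ⇒⊑ z-spells (⟦⟧-spells re₂) (L.∨-least {A₁} {A₂} {E₂}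
        (⊑⇒≤ᴮ (⟦⟧-spells ra₁) (⟦⟧-spells re₂) f₁₂) (⊑⇒≤ᴮ (⟦⟧-spells ra₂) (⟦⟧-spells re₂) f₂₂))
      decide : Dec (length z ≤ 2) → a₁ ≋ a₂ ⊎ e₁ ≋ e₂
      decide (yes l) = inj₁ (≋-trans
        (⊑∧length≥⇒≋ ra₁ (red z-spells) a₁⊑z (subst (length z ≤_) (sym la₁) l))
        (≋-sym (⊑∧length≥⇒≋ ra₂ (red z-spells) a₂⊑z (subst (length z ≤_) (sym la₂) l))))
      decide (no l) = inj₂ (≋-trans
        (≋-sym (⊑∧length≥⇒≋ (red z-spells) re₁ z⊑e₁ (subst (_≤ length z) (sym le₁) (≰⇒> l))))
        (⊑∧length≥⇒≋ (red z-spells) re₂ z⊑e₂ (subst (_≤ length z) (sym le₂) (≰⇒> l))))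

    -- The elements i k and j k both lie below i j k and j i k. Cancelling the last k shows that the
    -- upper two differ.
    no-before : ∀ {i j} → Adj i j → i ≢ k → j ≢ k → i ∷ j ∷ k ∷ [] ⊑ t → ¬ j ∷ i ∷ k ∷ [] ⊑ t
    no-before {i} {j} i~j i≢k j≢k f g = [ absurd₁ , absurd₂ ]′
      (no-square (Red-pair i≢k) (Red-pair j≢k) r₁ r₂ (there (here refl)) (there (here refl))
        refl refl refl refl
        (⊆⇒⊑ r₁ (refl ∷ j ∷ʳ refl ∷ [])) (⊆⇒⊑ r₂ (j ∷ʳ refl ∷ refl ∷ []))
        (⊆⇒⊑ r₁ (i ∷ʳ refl ∷ refl ∷ [])) (⊆⇒⊑ r₂ (refl ∷ i ∷ʳ refl ∷ [])) f g)
      where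
      r₁ = Red-triple (Adj⇒≢ i~j) i≢k j≢k
      r₂ = Red-triple (Adj⇒≢ i~j ∘ sym) j≢k i≢k
      i∉jk : i ∉ j ∷ k ∷ []
      i∉jk (here e)         = Adj⇒≢ i~j e
      i∉jk (there (here e)) = i≢k e
      absurd₁ : ¬ i ∷ k ∷ [] ≋ j ∷ k ∷ []
      absurd₁ e = i∉jk (∈-resp-⊑ (Red-pair i≢k) (Red-pair j≢k) (≋⇒⊑ e) (here refl))
      absurd₂ : ¬ i ∷ j ∷ k ∷ [] ≋ j ∷ i ∷ k ∷ []
      absurd₂ e = [ij]≋[ji]⇒¬Adj
        (≋-trans (≋-sym (≋-++ˡ (i ∷ j ∷ []) (∷∷-cancel k [])))
          (≋-trans (≋-++ʳ (k ∷ []) e) (≋-++ˡ (j ∷ i ∷ []) (∷∷-cancel k [])))) i~j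

    -- The mirror image: k i and k j both lie below k i j and k j i, and the first k is cancelled.
    no-after : ∀ {i j} → Adj i j → i ≢ k → j ≢ k → k ∷ i ∷ j ∷ [] ⊑ t → ¬ k ∷ j ∷ i ∷ [] ⊑ t
    no-after {i} {j} i~j i≢k j≢k f g = [ absurd₁ , absurd₂ ]′
      (no-square (Red-pair (i≢k ∘ sym)) (Red-pair (j≢k ∘ sym)) r₁ r₂ (here refl) (here refl)
        refl refl refl refl
        (⊆⇒⊑ r₁ (refl ∷ refl ∷ j ∷ʳ [])) (⊆⇒⊑ r₂ (refl ∷ j ∷ʳ refl ∷ []))
        (⊆⇒⊑ r₁ (refl ∷ i ∷ʳ refl ∷ [])) (⊆⇒⊑ r₂ (refl ∷ refl ∷ i ∷ʳ [])) f g)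
      where
      r₁ = Red-triple (i≢k ∘ sym) (j≢k ∘ sym) (Adj⇒≢ i~j)
      r₂ = Red-triple (j≢k ∘ sym) (i≢k ∘ sym) (Adj⇒≢ i~j ∘ sym)
      i∉kj : i ∉ k ∷ j ∷ []
      i∉kj (here e)         = i≢k e
      i∉kj (there (here e)) = Adj⇒≢ i~j e
      absurd₁ : ¬ k ∷ i ∷ [] ≋ k ∷ j ∷ []
      absurd₁ e = i∉kj
        (∈-resp-⊑ (Red-pair (i≢k ∘ sym)) (Red-pair (j≢k ∘ sym)) (≋⇒⊑ e) (there (here refl)))
      absurd₂ : ¬ k ∷ i ∷ j ∷ [] ≋ k ∷ j ∷ i ∷ []
      absurd₂ e = [ij]≋[ji]⇒¬Adj
        (≋-trans (≋-sym (∷∷-cancel k (i ∷ j ∷ [])))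
          (≋-trans (≋-∷ k e) (∷∷-cancel k (j ∷ i ∷ [])))) i~j

    -- With x = i k, y = k i j and z = i j k we have x ∨ y = k i j k ≥ z and y ∧ z = k ≤ x, against
    -- the modular law for x ≤ z.
    no-around : ∀ {i j} → Adj i k → Adj j k → i ≢ j → ¬ k ∷ i ∷ j ∷ k ∷ [] ⊑ t
    no-around {i} {j} i~k j~k i≢j kijk⊑t =
      contradiction (⊑-length r-ijk r-ik ijk⊑ik) λ { (s≤s (s≤s ())) }
      where
      i≢k = Adj⇒≢ i~k
      j≢k = Adj⇒≢ j~k
      k∉ij : k ∉ i ∷ j ∷ []
      k∉ij (here e)         = i≢k (sym e)
      k∉ij (there (here e)) = j≢k (sym e)
      adjacent : ∀ {c} → c ∈ i ∷ j ∷ [] → Adj c k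
      adjacent (here refl)         = i~k
      adjacent (there (here refl)) = j~k
      ik = i ∷ k ∷ []
      kij = k ∷ i ∷ j ∷ []
      ijk = i ∷ j ∷ k ∷ []
      kijk = k ∷ i ∷ j ∷ k ∷ []
      r-ik : Red ik
      r-ik = Red-pair i≢k
      r-kij : Red kij
      r-kij = Red-triple (i≢k ∘ sym) (j≢k ∘ sym) i≢j
      r-ijk : Red ijk
      r-ijk = Red-triple i≢j i≢k j≢k
      ik⊑ijk : ik ⊑ ijk
      ik⊑ijk = ⊆⇒⊑ r-ijk (refl ∷ j ∷ʳ refl ∷ [])
      -- Otherwise i k ≤ i j k lifts to k i k ≤ i j k. The lengths agree, so the two would be equal,
      -- but j does not occur in k i k.
      ascent : Ascent ijk k
      ascent = decide (pos ijk (toℕ k) <? pos ijk (suc (toℕ k)))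
        where
        j∉kik : j ∉ k ∷ i ∷ k ∷ []
        j∉kik (here e)                 = j≢k e
        j∉kik (there (here e))         = i≢j (sym e)
        j∉kik (there (there (here e))) = j≢k e
        decide : Dec (Ascent ijk k) → Ascent ijk k
        decide (yes a) = a
        decide (no ¬a) = contradiction
          (∈-resp-⊑ r-ijk (Red-iki (~-sym i~k))
            (≋⇒⊑ (≋-sym (⊑∧length≥⇒≋ (Red-iki (~-sym i~k)) r-ijk
              (descent-lift {i = k} ¬a ik⊑ijk) ≤-refl)))
            (there (here refl)))
          j∉kik
      r-kijk : Red kijk
      r-kijk = ascent ∷ r-ijk
      ik⊑t : ik ⊑ t
      ik⊑t = ⊑-trans (⊆⇒⊑ r-kijk (k ∷ʳ refl ∷ j ∷ʳ refl ∷ [])) kijk⊑t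
      kij⊑kijk : kij ⊑ kijk
      kij⊑kijk = ⊆⇒⊑ r-kijk (refl ∷ refl ∷ refl ∷ k ∷ʳ [])
      ijk⊑kijk : ijk ⊑ kijk
      ijk⊑kijk = ⊑-∷ ascent
      X = element r-ik (there (here refl)) ik⊑t
      Y = element r-kij (here refl) (⊑-trans kij⊑kijk kijk⊑t)
      Z = element r-ijk (there (there (here refl))) (⊑-trans ijk⊑kijk kijk⊑t)
      ⊤ = element r-kijk (here refl) kijk⊑t

      join = word (X ∨ Y)
      join-spells = word-spells (X ∨ Y)
      kij⊑join : kij ⊑ join
      kij⊑join = ≤ᴮ⇒⊑ (⟦⟧-spells r-kij) join-spells (L.y≤x∨y X Y)
      ik⋢kij : ¬ ik ⊑ kij
      ik⋢kij f = not-subword (adj-pair-⊑⇒⊆ i~k r-kij f)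
        where
        not-subword : ¬ ik ⊆ kij
        not-subword (_ ∷ʳ τ) = k∉ij (⊆-lookup τ (there (here refl)))
        not-subword (_ ∷ τ)  = k∉ij (to∈ τ)
      -- A join of length at most 3 would equal k i j, which is not above i k. So its length is at
      -- least 4, and it lies below k i j k.
      join≋kijk : join ≋ kijk
      join≋kijk = decide (length join ≤? 3)
        where
        decide : Dec (length join ≤ 3) → join ≋ kijk
        decide (yes l) = contradiction
          (⊑-trans (≤ᴮ⇒⊑ (⟦⟧-spells r-ik) join-spells (L.x≤x∨y X Y))
                   (≋⇒⊑ (≋-sym (⊑∧length≥⇒≋ r-kij (red join-spells) kij⊑join l)))) ik⋢kij
        decide (no l) = ⊑∧length≥⇒≋ (red join-spells) r-kijk
          (≤ᴮ⇒⊑ join-spells (⟦⟧-spells r-kijk) (L.∨-least {X} {Y} {⊤}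
            (⊑⇒≤ᴮ (⟦⟧-spells r-ik) (⟦⟧-spells r-kijk) (⊑-trans ik⊑ijk ijk⊑kijk))
            (⊑⇒≤ᴮ (⟦⟧-spells r-kij) (⟦⟧-spells r-kijk) kij⊑kijk))) (≰⇒> l)
      Z≤X∨Y : Z I.∼ (X ∨ Y)
      Z≤X∨Y = ⊑⇒≤ᴮ (⟦⟧-spells r-ijk) join-spells (⊑-trans ijk⊑kijk (≋⇒⊑ (≋-sym join≋kijk)))

      meet = word (Y ∧ Z)
      meet-spells = word-spells (Y ∧ Z)
      meet⊑ijk : meet ⊑ ijk
      meet⊑ijk = ≤ᴮ⇒⊑ meet-spells (⟦⟧-spells r-ijk) (L.x∧y≤y Y Z)
      kc⋢ijk : ∀ {c} → Adj c k → ¬ k ∷ c ∷ [] ⊑ ijk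
      kc⋢ijk {c} c~k f = not-subword (pair-++⁻ (i ∷ j ∷ []) (adj-pair-⊑⇒⊆ (~-sym c~k) r-ijk f))
        where
        not-subword : ¬ (k ∷ c ∷ [] ⊆ i ∷ j ∷ [] ⊎ (k ∈ i ∷ j ∷ [] × c ∈ k ∷ []) ⊎ k ∷ c ∷ [] ⊆ k ∷ [])
        not-subword (inj₁ τ)                 = k∉ij (to∈ τ)
        not-subword (inj₂ (inj₁ (p , _)))    = k∉ij p
        not-subword (inj₂ (inj₂ (_ ∷ʳ ())))
        not-subword (inj₂ (inj₂ (_ ∷ ())))
      -- The meet is spelled by a subword of k i j that contains k. Any further letter c would put k
      -- c below i j k, where k comes last; hence the meet is k.
      meet⊑ik : meet ⊑ ik
      meet⊑ik = cases (⊑⇒subword r-kij (≤ᴮ⇒⊑ meet-spells (⟦⟧-spells r-kij) (L.x∧y≤x Y Z)))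
        where
        cases : (∃ λ s → s ⊆ kij × Red s × s ≋ meet) → meet ⊑ ik
        cases (s , _ ∷ʳ τ , r , e) = contradiction
          (⊆-lookup τ (∈-resp-⊑ (red meet-spells) r (≋⇒⊑ (≋-sym e)) (k∈word (Y ∧ Z)))) k∉ij
        cases (_ ∷ [] , refl ∷ _ , _ , e) = ⊑-trans (≋⇒⊑ (≋-sym e)) (⊆⇒⊑ r-ik (i ∷ʳ refl ∷ []))
        cases (_ ∷ c ∷ _ , refl ∷ τ , r , e) = contradiction
          (⊑-trans (⊆⇒⊑ r (refl ∷ refl ∷ minimum _)) (⊑-trans (≋⇒⊑ e) meet⊑ijk))
          (kc⋢ijk (adjacent (to∈ τ)))

      Z≤X : Z I.∼ X
      Z≤X = modular-collapse [ σ k , w ] modular {X} {Y} {Z}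
        (⊑⇒≤ᴮ (⟦⟧-spells r-ik) (⟦⟧-spells r-ijk) ik⊑ijk) Z≤X∨Y
        (⊑⇒≤ᴮ meet-spells (⟦⟧-spells r-ik) meet⊑ik)
      ijk⊑ik : ijk ⊑ ik
      ijk⊑ik = ≤ᴮ⇒⊑ (⟦⟧-spells r-ijk) (⟦⟧-spells r-ik) Z≤X

  Modular⇒Unobstructed : Unobstructed k t
  Modular⇒Unobstructed = record { before = no-before ; after = no-after ; around = no-around }

theorem5p1 : ∀ (m : ℕ) (k : Fin m) (w : 𝔖 m) → σ k ≤ᴮ w →
    (Boolean [ σ k , w ] ⇔
    (∃ λ (x : Word m) → ∃ λ (y : Word m) →
    (x ++ k ∷ y) ∈R w ×
    (Unique x × Unique y) ×
    (∀ i → i ∈ x → i ∈ y → suc (toℕ i) ≡ toℕ k ⊎ toℕ i ≡ suc (toℕ k)) ×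
    (k ∉ x × k ∉ y))) ×
    (Boolean [ σ k , w ] ⇔ ModularLattice [ σ k , w ]) ×
    (Boolean [ σ k , w ] ⇔ DistributiveLattice [ σ k , w ])
theorem5p1 m k w σk≤w@(_ , t , _ , t∈R , _) =
  -- All equivalences follow from one cycle: boolean, distributive, modular, factorised as x k y,
  -- boolean.
  mk⇔ (modular⇒good ∘ Distributive⇒Modular I ∘ Boolean⇒Distributive I) good⇒boolean ,
  mk⇔ (Distributive⇒Modular I ∘ Boolean⇒Distributive I) (good⇒boolean ∘ modular⇒good) ,
  mk⇔ (Boolean⇒Distributive I) (good⇒boolean ∘ modular⇒good ∘ Distributive⇒Modular I)
  where
  I = [ σ k , w ]
  t-spells : t spells w
  t-spells = ∈R⇒spells t w t∈R
  good⇒boolean : (∃ λ x → ∃ λ y → (x ++ k ∷ y) ∈R w × Good k x y) → Boolean I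
  good⇒boolean (x , y , ω∈R , good) = Good⇒Boolean good (∈R⇒spells (x ++ k ∷ y) w ω∈R)
  modular⇒good : ModularLattice I → ∃ λ x → ∃ λ y → (x ++ k ∷ y) ∈R w × Good k x y
  modular⇒good modular =
    let r = red t-spells
        x , y , good , e = factorise r ([i]⊑⇒∈ r (≤ᴮ⇒⊑ ([-]-spells k) t-spells σk≤w))
                             (Modular⇒Unobstructed t-spells modular)
    in x , y , spells⇒∈R (spells-cong (Good⇒Red x good) e t-spells) , good
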